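{- Let $\mathbf{w}\in\mathcal{K}_{m+}\setminus\{\mathbf{0}\}\subset\mathbb{R}^n$, $\varepsilon>0$, and $\mathbf{v}\in\mathbb{R}^n$. If $\Omega_{\mathbf{w}}(\mathbf{v})\le\varepsilon$, then $\mathrm{proj}_{\mathcal{G}_\varepsilon^{\mathbf{w}}}(\mathbf{v})=\mathbf{v}$. If $\Omega_{\mathbf{w}}(\mathbf{v})>\varepsilon$, let $\mathbf{u}=|\mathbf{v}|_{\downarrow}=\mathbf{P}(|\mathbf{v}|)|\mathbf{v}|$, let $\bar{w}=\|\mathbf{w}\|_1/n$, and define $$g(\theta)=\mathbf{w}^T\,\mathrm{proj}_{\mathcal{K}_{m+}}(\mathbf{u}-\theta\,\mathbf{w})-\varepsilon,\qquad\theta\ge 0.$$ Then $g$ has a root in the interval $[0,\,u_1/\bar{w}]$, and for any root $\theta^*$ of $g$ in this interval, $$\mathrm{proj}_{\mathcal{G}_\varepsilon^{\mathbf{w}}}(\mathbf{v})=\mathrm{sign}(\mathbf{v})\odot\bigl(\mathbf{P}(|\mathbf{v}|)^T\,\mathrm{proj}_{\mathcal{K}_{m+}}(\mathbf{u}-\theta^*\mathbf{w})\bigr).$$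
   Context: $\mathcal{K}_{m+}=\{\mathbf{x}\in\mathbb{R}^n: x_1\ge x_2\ge\cdots\ge x_n\ge 0\}$ is the monotone non-negative cone. For $\mathbf{x}\in\mathbb{R}^n$, $|\mathbf{x}|$ is the vector of absolute values of its components, $|\mathbf{x}|_{\downarrow}$ is that vector sorted in non-increasing order, and $\mathbf{P}(|\mathbf{x}|)$ is a permutation matrix (ties broken arbitrarily) such that $|\mathbf{x}|_{\downarrow}=\mathbf{P}(|\mathbf{x}|)\,|\mathbf{x}|$. The ordered weighted $\ell_1$ (OWL) norm is $\Omega_{\mathbf{w}}(\mathbf{x})=\mathbf{w}^T|\mathbf{x}|_{\downarrow}$, and $\mathcal{G}_\varepsilon^{\mathbf{w}}=\{\mathbf{x}\in\mathbb{R}^n:\Omega_{\mathbf{w}}(\mathbf{x})\le\varepsilon\}$. $\mathrm{proj}_C$ denotes the Euclidean projection onto a closed convex set $C$; $\mathrm{sign}$ is applied component-wise and $\odot$ is the entry-wise product. -}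

module Defs where

open import Algebra.Bundles using (CommutativeRing)
import Algebra.Properties.CommutativeMonoid.Sum as Sum
import Algebra.Properties.Monoid.Mult as Mult
open import Axiom.ExcludedMiddle using (ExcludedMiddle)
open import Data.Bool.Base using (if_then_else_)
open import Data.Fin.Base as Fin using (Fin; cast)
open import Data.Fin.Permutation using (Permutation′; _⟨$⟩ʳ_)
import Data.Fin.Properties as Fin
open import Data.List.Base using (length; lookup)
open import Data.List.Properties using (length-tabulate)
open import Data.List.Relation.Binary.Permutation.Propositional.Properties
  using (↭-length)
import Data.List.Sort as Sort
open import Data.Nat.Base using (ℕ)
open import Data.Product.Base using (Σ; ∃; _×_; _,_)
open import Data.Vec.Functional using (Vector; map; zipWith; replicate; toList)
import Data.Vec.Functional.Relation.Binary.Equality.Setoid as VecEquality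
open import Level using (0ℓ)
open import Relation.Binary.Bundles using (DecTotalOrder)
open import Relation.Binary.Core using (Rel)
open import Relation.Binary.Structures using (IsTotalOrder)
import Relation.Binary.Construct.Flip.EqAndOrd as Flip
import Relation.Binary.Construct.NonStrictToStrict as ToStrict
open import Relation.Binary.PropositionalEquality.Core using (_≡_; sym; trans)
open import Relation.Nullary using (¬_; yes; no; does)
open import Relation.Unary using (Pred; _∈_; Satisfiable)

-- The reals, given by the axioms that determine them up to isomorphism.
record CompleteOrderedField : Set₁ where
  infix  4 _≤_
  infix  8 _⁻¹
  field
    commutativeRing : CommutativeRing 0ℓ 0ℓ

  open CommutativeRing commutativeRing public
    hiding (sym; trans)

  field
    -- 0# ⁻¹ is unconstrained.
    _⁻¹          : Carrier → Carrier
    0≉1          : ¬ (0# ≈ 1#)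
    *-inverseʳ   : ∀ x → ¬ (x ≈ 0#) → x * x ⁻¹ ≈ 1#
    _≤_          : Rel Carrier 0ℓ
    isTotalOrder : IsTotalOrder _≈_ _≤_
    +-monoʳ-≤    : ∀ x {y z} → y ≤ z → x + y ≤ x + z
    *-nonNeg     : ∀ {x y} → 0# ≤ x → 0# ≤ y → 0# ≤ x * y

  UpperBound : Pred Carrier 0ℓ → Pred Carrier 0ℓ
  UpperBound S b = ∀ x → x ∈ S → x ≤ b

  field
    supremum : ∀ (S : Pred Carrier 0ℓ) → Satisfiable S → Satisfiable (UpperBound S) →
               ∃ λ s → s ∈ UpperBound S × (∀ b → b ∈ UpperBound S → s ≤ b)

  open ToStrict _≈_ _≤_ public using (_<_)

module OWL (em : ExcludedMiddle 0ℓ) (ℝ : CompleteOrderedField) where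

  open CompleteOrderedField ℝ public
    using (Carrier; _≈_; _+_; _*_; -_; _-_; 0#; 1#; _⁻¹; _≤_; _<_)
  open CompleteOrderedField ℝ using (setoid; isTotalOrder; +-commutativeMonoid; +-monoid)
  open VecEquality setoid public using (_≋_)
  open Sum +-commutativeMonoid using (sum)
  open Mult +-monoid using () renaming (_×_ to _×ₙ_)

  fromℕ : ℕ → Carrier
  fromℕ k = k ×ₙ 1#

  decTotalOrder : DecTotalOrder 0ℓ 0ℓ 0ℓ
  decTotalOrder = record
    { isDecTotalOrder = record
      { isTotalOrder = isTotalOrder
      ; _≟_          = λ _ _ → em
      ; _≤?_         = λ _ _ → em
      }
    }

  open DecTotalOrder decTotalOrder using (_≟_; _≤?_)

  module Descending = Sort (Flip.decTotalOrder decTotalOrder)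

  abs : Carrier → Carrier
  abs x = if does (0# ≤? x) then x else - x

  signum : Carrier → Carrier
  signum x = if does (x ≟ 0#) then 0# else if does (0# ≤? x) then 1# else - 1#

  module _ {n : ℕ} where

    infixl 6 _-ᵛ_
    infixr 7 _·ᵛ_ _⊙_
    infix  7 _∙_

    0ᵛ : Vector Carrier n
    0ᵛ = replicate n 0#

    _-ᵛ_ _⊙_ : Vector Carrier n → Vector Carrier n → Vector Carrier n
    _-ᵛ_ = zipWith _-_
    _⊙_  = zipWith _*_

    _·ᵛ_ : Carrier → Vector Carrier n → Vector Carrier n
    a ·ᵛ x = map (a *_) x

    _∙_ : Vector Carrier n → Vector Carrier n → Carrier
    x ∙ y = sum (x ⊙ y)

    sign ∣_∣ : Vector Carrier n → Vector Carrier n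
    sign = map signum
    ∣_∣  = map abs

    ‖_‖₁ : Vector Carrier n → Carrier
    ‖ x ‖₁ = sum ∣ x ∣

    sort↓ : Vector Carrier n → Vector Carrier n
    sort↓ x i = lookup sorted (cast (sym length-sorted) i)
      where
      sorted = Descending.sort (toList x)

      length-sorted : length sorted ≡ n
      length-sorted = trans (↭-length (Descending.sort-↭ (toList x))) (length-tabulate x)

    ∣_∣↓ : Vector Carrier n → Vector Carrier n
    ∣ x ∣↓ = sort↓ ∣ x ∣

    -- Squared, so that no square root is needed; the minimisers are the
    -- same as for the Euclidean distance itself.
    distance² : Vector Carrier n → Vector Carrier n → Carrier
    distance² x y = (x -ᵛ y) ∙ (x -ᵛ y)

    IsNearestPoint : Pred (Vector Carrier n) 0ℓ → Vector Carrier n → Pred (Vector Carrier n) 0ℓ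
    IsNearestPoint C x p = p ∈ C × (∀ y → y ∈ C → distance² x p ≤ distance² x y)

    -- A nearest point of C exists and is unique up to _≋_ when C is nonempty,
    -- closed and convex; if there is none, the value 0ᵛ is a dummy.
    proj : Pred (Vector Carrier n) 0ℓ → Vector Carrier n → Vector Carrier n
    proj C x with em {Σ (Vector Carrier n) (IsNearestPoint C x)}
    ... | yes (p , _) = p
    ... | no  _       = 0ᵛ

    𝒦ₘ₊ : Pred (Vector Carrier n) 0ℓ
    𝒦ₘ₊ x = (∀ i j → i Fin.≤ j → x j ≤ x i) × (∀ i → 0# ≤ x i)

    Ω : Vector Carrier n → Vector Carrier n → Carrier
    Ω w x = w ∙ ∣ x ∣↓

    𝒢 : Carrier → Vector Carrier n → Pred (Vector Carrier n) 0ℓ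
    𝒢 ε w x = Ω w x ≤ ε

    Matrix : Set
    Matrix = Fin n → Fin n → Carrier

    infixr 7 _*ᵥ_
    infix  8 _ᵀ

    _*ᵥ_ : Matrix → Vector Carrier n → Vector Carrier n
    (M *ᵥ x) i = M i ∙ x

    _ᵀ : Matrix → Matrix
    (M ᵀ) i j = M j i

    permutationMatrix : Permutation′ n → Matrix
    permutationMatrix σ i j = if does (σ ⟨$⟩ʳ i Fin.≟ j) then 1# else 0#

{-# OPTIONS --safe #-}

-- The projection z of u - θw onto the cone 𝒦ₘ₊ is characterised by
-- (u - θw)∙y ≤ z∙y for all y ∈ 𝒦ₘ₊, with equality at y = z. If w∙z = ε, then
-- (u - z)∙(y - z) ≤ θ (w∙y - ε) ≤ 0 for every y ∈ 𝒦ₘ₊ with w∙y ≤ ε, so z is the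
-- point nearest to u among those y. By the rearrangement inequality sorting
-- does not increase distances, and undoing the sorting and the signs carries z
-- to a nearest point of 𝒢 ε w to v; nearest points are unique because
-- Ω w x = max_π w∙π|x| makes 𝒢 ε w midpoint convex.
--
-- Projections onto 𝒦ₘ₊ exist by induction on the dimension: if q is the
-- projection of the tail of x, that of x is t followed by the entries q i ⊓ t,
-- with t determined by an intermediate value argument. The same argument gives
-- the root of g, which is positive at 0 and, by Chebyshev's sum inequality,
-- equals -ε at u₁/w̄.

module Submission where

open import Defs
import Algebra.Construct.NaturalChoice.Min as Min
open import Algebra.Bundles using (CommutativeRing)
import Algebra.Properties.AbelianGroup as AbelianGroupProperties
import Algebra.Properties.CommutativeMonoid.Sum as Sum
import Algebra.Properties.Ring as RingProperties
import Algebra.Properties.Semiring.Mult.TCOptimised as SemiringMult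
import Algebra.Properties.Semiring.Sum as SemiringSum
import Algebra.Solver.Ring as RingSolver
open import Algebra.Solver.Ring.AlmostCommutativeRing
  using (_-Raw-AlmostCommutative⟶_; fromCommutativeRing)
open import Axiom.ExcludedMiddle using (ExcludedMiddle)
open import Data.Bool.Base using (if_then_else_)
open import Data.Fin.Base as Fin using (Fin; zero; suc; punchIn)
open import Data.Fin.Permutation as Perm using (Permutation′; _⟨$⟩ʳ_; _⟨$⟩ˡ_)
import Data.Fin.Properties as Fin
open import Data.Integer.Base as ℤ using (ℤ; +_; -[1+_])
import Data.Integer.Properties as ℤ
import Data.List.Base as List
import Data.List.Properties as List
open import Data.List.Relation.Binary.Permutation.Homogeneous using (onIndices)
open import Data.List.Relation.Binary.Permutation.Propositional using (↭⇒↭ₛ)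
open import Data.List.Relation.Binary.Permutation.Propositional.Properties using (↭-length)
open import Data.List.Relation.Binary.Permutation.Setoid.Properties using (onIndices-lookup)
open import Data.List.Relation.Unary.Sorted.TotalOrder.Properties using (lookup-mono-≤)
import Data.Maybe.Base as Maybe
open import Data.Nat.Base as ℕ using (ℕ; zero; suc; z≤n; s≤s)
import Data.Nat.Properties as ℕ
open import Data.Product.Base using (∃; _×_; _,_; proj₁; proj₂)
open import Data.Sum.Base using (_⊎_; inj₁; inj₂)
open import Data.Vec.Functional using (Vector; toList)
open import Function.Base using (_∘_)
open import Level using (0ℓ)
open import Relation.Binary.Bundles using (DecTotalOrder; TotalOrder)
import Relation.Binary.Construct.Flip.EqAndOrd as Flip
open import Relation.Binary.PropositionalEquality.Core as ≡ using (_≡_; _≢_)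
import Relation.Binary.PropositionalEquality.Properties as ≡
import Relation.Binary.Reasoning.PartialOrder as ≤-Reasoning
import Relation.Binary.Reasoning.Setoid as ≈-Reasoning
open import Relation.Nullary using (¬_; yes; no; contradiction)
open import Relation.Nullary.Decidable using (dec⇒maybe; dec-true; dec-false)
open import Relation.Unary using (Pred; _∈_)

-- Ring solver with integer coefficients.

module IntegerCoefficients {c ℓ} (R : CommutativeRing c ℓ) where

  open CommutativeRing R
  open RingProperties ring
  open AbelianGroupProperties +-abelianGroup using (⁻¹-∙-comm)
  open SemiringMult semiring renaming (_×_ to _×ₙ_)
  open ≈-Reasoning setoid

  -- Coefficients are taken in ℤ because equality there is decided by computation. With the
  -- optimised multiple `⟦ + 1 ⟧` reduces to `1#`, so `con (+ 1)` in a solver equation stands for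
  -- `1#` itself.
  ⟦_⟧ : ℤ → Carrier
  ⟦ + n ⟧      = n ×ₙ 1#
  ⟦ -[1+ n ] ⟧ = - (suc n ×ₙ 1#)

  +-cancelˡ-diff : ∀ a b c → (a + b) - (a + c) ≈ b - c
  +-cancelˡ-diff a b c = begin
    (a + b) - (a + c)       ≈⟨ +-cong (+-comm a b) (sym (⁻¹-∙-comm a c)) ⟩
    (b + a) + (- a + - c)   ≈⟨ +-assoc b a _ ⟩
    b + (a + (- a + - c))   ≈⟨ +-congˡ (sym (+-assoc a (- a) (- c))) ⟩
    b + ((a - a) + - c)     ≈⟨ +-congˡ (+-congʳ (-‿inverseʳ a)) ⟩
    b + (0# + - c)          ≈⟨ +-congˡ (+-identityˡ (- c)) ⟩
    b - c                   ∎

  ⊖-homo : ∀ m n → ⟦ m ℤ.⊖ n ⟧ ≈ m ×ₙ 1# - n ×ₙ 1#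
  ⊖-homo zero    zero    = sym (-‿inverseʳ 0#)
  ⊖-homo zero    (suc n) = sym (+-identityˡ _)
  ⊖-homo (suc m) zero    = sym (trans (+-congˡ -0#≈0#) (+-identityʳ _))
  ⊖-homo (suc m) (suc n) = begin
    ⟦ suc m ℤ.⊖ suc n ⟧            ≡⟨ ≡.cong ⟦_⟧ (ℤ.[1+m]⊖[1+n]≡m⊖n m n) ⟩
    ⟦ m ℤ.⊖ n ⟧                    ≈⟨ ⊖-homo m n ⟩
    m ×ₙ 1# - n ×ₙ 1#              ≈⟨ +-cancelˡ-diff 1# _ _ ⟨
    (1# + m ×ₙ 1#) - (1# + n ×ₙ 1#)  ≈⟨ +-cong (1+× m 1#) (-‿cong (1+× n 1#)) ⟨
    suc m ×ₙ 1# - suc n ×ₙ 1#      ∎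

  +-homo : ∀ i j → ⟦ i ℤ.+ j ⟧ ≈ ⟦ i ⟧ + ⟦ j ⟧
  +-homo (+ m)    (+ n)    = ×-homo-+ 1# m n
  +-homo (+ m)    -[1+ n ] = ⊖-homo m (suc n)
  +-homo -[1+ m ] (+ n)    = trans (⊖-homo n (suc m)) (+-comm _ _)
  +-homo -[1+ m ] -[1+ n ] = begin
    - (suc (suc (m ℕ.+ n)) ×ₙ 1#)          ≡⟨ ≡.cong (λ k → - (k ×ₙ 1#)) (≡.cong suc (ℕ.+-suc m n)) ⟨
    - ((suc m ℕ.+ suc n) ×ₙ 1#)            ≈⟨ -‿cong (×-homo-+ 1# (suc m) (suc n)) ⟩
    - (suc m ×ₙ 1# + suc n ×ₙ 1#)          ≈⟨ ⁻¹-∙-comm _ _ ⟨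
    - (suc m ×ₙ 1#) + - (suc n ×ₙ 1#)      ∎

  -‿homo : ∀ i → ⟦ ℤ.- i ⟧ ≈ - ⟦ i ⟧
  -‿homo (+ zero)   = sym -0#≈0#
  -‿homo (+ suc n)  = refl
  -‿homo -[1+ n ]   = sym (-‿involutive _)

  pos-*-homo : ∀ m j → ⟦ + m ℤ.* j ⟧ ≈ ⟦ + m ⟧ * ⟦ j ⟧
  pos-*-homo m (+ n) = begin
    ⟦ + m ℤ.* + n ⟧        ≡⟨ ≡.cong ⟦_⟧ (ℤ.pos-* m n) ⟨
    (m ℕ.* n) ×ₙ 1#        ≈⟨ ×1-homo-* m n ⟩
    m ×ₙ 1# * n ×ₙ 1#      ∎
  pos-*-homo m -[1+ n ] = begin
    ⟦ + m ℤ.* (ℤ.- + suc n) ⟧    ≡⟨ ≡.cong ⟦_⟧ (ℤ.neg-distribʳ-* (+ m) (+ suc n)) ⟨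
    ⟦ ℤ.- (+ m ℤ.* + suc n) ⟧    ≈⟨ -‿homo (+ m ℤ.* + suc n) ⟩
    - ⟦ + m ℤ.* + suc n ⟧        ≈⟨ -‿cong (pos-*-homo m (+ suc n)) ⟩
    - (m ×ₙ 1# * suc n ×ₙ 1#)    ≈⟨ -‿distribʳ-* _ _ ⟩
    m ×ₙ 1# * - (suc n ×ₙ 1#)    ∎
  *-homo : ∀ i j → ⟦ i ℤ.* j ⟧ ≈ ⟦ i ⟧ * ⟦ j ⟧
  *-homo (+ m)    j = pos-*-homo m j
  *-homo -[1+ m ] j = begin
    ⟦ (ℤ.- + suc m) ℤ.* j ⟧    ≡⟨ ≡.cong ⟦_⟧ (ℤ.neg-distribˡ-* (+ suc m) j) ⟨
    ⟦ ℤ.- (+ suc m ℤ.* j) ⟧    ≈⟨ -‿homo (+ suc m ℤ.* j) ⟩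
    - ⟦ + suc m ℤ.* j ⟧        ≈⟨ -‿cong (pos-*-homo (suc m) j) ⟩
    - (suc m ×ₙ 1# * ⟦ j ⟧)    ≈⟨ -‿distribˡ-* _ _ ⟩
    - (suc m ×ₙ 1#) * ⟦ j ⟧    ∎

  morphism : ℤ.+-*-rawRing -Raw-AlmostCommutative⟶ fromCommutativeRing R
  morphism = record
    { ⟦_⟧    = ⟦_⟧
    ; +-homo = +-homo
    ; *-homo = *-homo
    ; -‿homo = -‿homo
    ; 0-homo = refl
    ; 1-homo = refl
    }

  open RingSolver ℤ.+-*-rawRing (fromCommutativeRing R) morphism
    (λ i j → Maybe.map (reflexive ∘ ≡.cong ⟦_⟧) (dec⇒maybe (i ℤ.≟ j))) public
    using (solve; _:=_; _:+_; _:*_; _:-_; :-_; con)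

-- Arithmetic in an ordered field.

module OrderedField (ℝ : CompleteOrderedField) where

  open CompleteOrderedField ℝ public hiding (zero)
  open CommutativeRing commutativeRing public using (sym; trans)
  open IntegerCoefficients commutativeRing public

  totalOrder : TotalOrder 0ℓ 0ℓ 0ℓ
  totalOrder = record { isTotalOrder = isTotalOrder }

  open TotalOrder totalOrder public using (poset; total; antisym)
    renaming (refl to ≤-refl; reflexive to ≤-reflexive; trans to ≤-trans)
  open Min totalOrder public
  open ≤-Reasoning poset public

  ≤-respˡ-≈ : ∀ {x y z} → x ≈ y → x ≤ z → y ≤ z
  ≤-respˡ-≈ x≈y = ≤-trans (≤-reflexive (sym x≈y))

  ≤-respʳ-≈ : ∀ {x y z} → x ≈ y → z ≤ x → z ≤ y
  ≤-respʳ-≈ x≈y z≤x = ≤-trans z≤x (≤-reflexive x≈y)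

  diff-nonNeg : ∀ {x y} → x ≤ y → 0# ≤ y - x
  diff-nonNeg {x} {y} x≤y = begin
    0#       ≈⟨ -‿inverseˡ x ⟨
    - x + x  ≤⟨ +-monoʳ-≤ (- x) x≤y ⟩
    - x + y  ≈⟨ +-comm (- x) y ⟩
    y - x    ∎

  -- Reduces an inequality to a ring identity that exhibits y - x as a
  -- manifestly nonnegative expression.
  ≤-from-diff : ∀ {x y c} → 0# ≤ c → y - x ≈ c → x ≤ y
  ≤-from-diff {x} {y} {c} 0≤c eq = begin
    x            ≈⟨ +-identityʳ x ⟨
    x + 0#       ≤⟨ +-monoʳ-≤ x 0≤c ⟩
    x + c        ≈⟨ +-congˡ eq ⟨
    x + (y - x)  ≈⟨ solve 2 (λ x y → x :+ (y :- x) := y) refl x y ⟩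
    y            ∎

  +-mono-≤ : ∀ {x y u v} → x ≤ y → u ≤ v → x + u ≤ y + v
  +-mono-≤ {x} {y} {u} {v} x≤y u≤v = begin
    x + u  ≤⟨ +-monoʳ-≤ x u≤v ⟩
    x + v  ≈⟨ +-comm x v ⟩
    v + x  ≤⟨ +-monoʳ-≤ v x≤y ⟩
    v + y  ≈⟨ +-comm v y ⟩
    y + v  ∎

  +-nonNeg : ∀ {x y} → 0# ≤ x → 0# ≤ y → 0# ≤ x + y
  +-nonNeg 0≤x 0≤y = ≤-respˡ-≈ (+-identityˡ 0#) (+-mono-≤ 0≤x 0≤y)

  x≤x+y : ∀ {x y} → 0# ≤ y → x ≤ x + y
  x≤x+y {x} {y} 0≤y = ≤-from-diff 0≤y (solve 2 (λ x y → (x :+ y) :- x := y) refl x y)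

  neg-nonNeg : ∀ {x} → x ≤ 0# → 0# ≤ - x
  neg-nonNeg {x} x≤0 = ≤-respʳ-≈ (+-identityˡ (- x)) (diff-nonNeg x≤0)

  neg-mono-≤ : ∀ {x y} → x ≤ y → - y ≤ - x
  neg-mono-≤ {x} {y} x≤y = ≤-from-diff (diff-nonNeg x≤y)
    (solve 2 (λ x y → :- x :- :- y := y :- x) refl x y)

  *-monoˡ-≤ : ∀ {a x y} → 0# ≤ a → x ≤ y → a * x ≤ a * y
  *-monoˡ-≤ {a} {x} {y} 0≤a x≤y = ≤-from-diff (*-nonNeg 0≤a (diff-nonNeg x≤y))
    (solve 3 (λ a x y → a :* y :- a :* x := a :* (y :- x)) refl a x y)

  *-monoʳ-≤ : ∀ {a x y} → 0# ≤ a → x ≤ y → x * a ≤ y * a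
  *-monoʳ-≤ {a} {x} {y} 0≤a x≤y =
    ≤-respˡ-≈ (*-comm a x) (≤-respʳ-≈ (*-comm a y) (*-monoˡ-≤ 0≤a x≤y))

  -- Lets midpoints be treated in the doubled form `m + m ≈ p + q`, without dividing by two.
  double-cancel-≤ : ∀ {x y} → x + x ≤ y + y → x ≤ y
  double-cancel-≤ {x} {y} 2x≤2y with total x y
  ... | inj₁ x≤y = x≤y
  ... | inj₂ y≤x = ≤-from-diff (+-nonNeg (diff-nonNeg 2x≤2y) (diff-nonNeg y≤x))
    (solve 2 (λ x y → y :- x := ((y :+ y) :- (x :+ x)) :+ (x :- y)) refl x y)

  square-nonNeg : ∀ x → 0# ≤ x * x
  square-nonNeg x with total 0# x
  ... | inj₁ 0≤x = *-nonNeg 0≤x 0≤x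
  ... | inj₂ x≤0 = ≤-respʳ-≈ (solve 1 (λ x → :- x :* :- x := x :* x) refl x)
                     (*-nonNeg (neg-nonNeg x≤0) (neg-nonNeg x≤0))

  0≤1 : 0# ≤ 1#
  0≤1 = ≤-respʳ-≈ (*-identityˡ 1#) (square-nonNeg 1#)

  ⁻¹-nonNeg : ∀ {x} → 0# ≤ x → ¬ x ≈ 0# → 0# ≤ x ⁻¹
  ⁻¹-nonNeg {x} 0≤x x≉0 with total 0# (x ⁻¹)
  ... | inj₁ 0≤x⁻¹ = 0≤x⁻¹
  ... | inj₂ x⁻¹≤0 = contradiction (antisym 0≤1 1≤0) 0≉1
    where
    1≤0 : 1# ≤ 0#
    1≤0 = begin
      1#        ≈⟨ *-inverseʳ x x≉0 ⟨
      x * x ⁻¹  ≤⟨ *-monoˡ-≤ 0≤x x⁻¹≤0 ⟩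
      x * 0#    ≈⟨ zeroʳ x ⟩
      0#        ∎

  *-cancelˡ-≤ : ∀ {a x y} → 0# ≤ a → ¬ a ≈ 0# → a * x ≤ a * y → x ≤ y
  *-cancelˡ-≤ {a} {x} {y} 0≤a a≉0 ax≤ay = begin
    x               ≈⟨ shift x ⟨
    a ⁻¹ * (a * x)  ≤⟨ *-monoˡ-≤ (⁻¹-nonNeg 0≤a a≉0) ax≤ay ⟩
    a ⁻¹ * (a * y)  ≈⟨ shift y ⟩
    y               ∎
    where
    shift : ∀ z → a ⁻¹ * (a * z) ≈ z
    shift z = begin-equality
      a ⁻¹ * (a * z)  ≈⟨ solve 3 (λ a b z → b :* (a :* z) := (a :* b) :* z) refl a (a ⁻¹) z ⟩
      a * a ⁻¹ * z    ≈⟨ *-congʳ (*-inverseʳ a a≉0) ⟩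
      1# * z          ≈⟨ *-identityˡ z ⟩
      z               ∎

  -- An intermediate value theorem from a bound on the rate of descent.

  module _ (f : Carrier → Carrier) {L b : Carrier}
           (0≤L : 0# ≤ L) (L≉0 : ¬ L ≈ 0#) (0≤b : 0# ≤ b)
           (lipschitz : ∀ {s t} → s ≤ t → f s ≤ f t + L * (t - s))
           (0≤f0 : 0# ≤ f 0#) (fb≤0 : f b ≤ 0#) where

    private
      -- The root will be the supremum `s` of this set.
      S : Carrier → Set
      S t = t ≤ b × 0# ≤ f t

      sup = supremum S (0# , 0≤b , 0≤f0) (b , λ _ → proj₁)
      s   = proj₁ sup

      bound : ∀ {t} → S t → t ≤ s
      bound {t} = proj₁ (proj₂ sup) t

      least : ∀ {c} → (∀ t → S t → t ≤ c) → s ≤ c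
      least {c} = proj₂ (proj₂ sup) c

      s≤b : s ≤ b
      s≤b = least (λ _ → proj₁)

      L*[x*L⁻¹]≈x : ∀ x → L * (x * L ⁻¹) ≈ x
      L*[x*L⁻¹]≈x x = begin-equality
        L * (x * L ⁻¹)  ≈⟨ solve 3 (λ l x k → l :* (x :* k) := x :* (l :* k)) refl L x (L ⁻¹) ⟩
        x * (L * L ⁻¹)  ≈⟨ *-congˡ (*-inverseʳ L L≉0) ⟩
        x * 1#          ≈⟨ *-identityʳ x ⟩
        x               ∎

      0≤L⁻¹ : 0# ≤ L ⁻¹
      0≤L⁻¹ = ⁻¹-nonNeg 0≤L L≉0

      -- Since `f` falls at rate at most `L`, it stays nonnegative from `s` up to `s + f s * L ⁻¹`.
      -- Points of that stretch up to `b` therefore belong to `S`, which `s` bounds.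
      no-later : ∀ {t} → s ≤ t → t ≤ s + f s * L ⁻¹ → t ≤ b → t ≤ s
      no-later {t} s≤t t≤s+δ t≤b = bound (t≤b , ≤-from-diff
        (+-nonNeg (diff-nonNeg (lipschitz s≤t)) (*-nonNeg 0≤L (diff-nonNeg t≤s+δ)))
        (begin-equality
          f t - 0#
            ≈⟨ solve 5 (λ x y l s t → x :- con (+ 0) := ((x :+ l :* (t :- s)) :- y) :+ (y :- l :* (t :- s)))
                 refl (f t) (f s) L s t ⟩
          (f t + L * (t - s) - f s) + (f s - L * (t - s))
            ≈⟨ +-congˡ (+-congʳ (L*[x*L⁻¹]≈x (f s))) ⟨
          (f t + L * (t - s) - f s) + (L * (f s * L ⁻¹) - L * (t - s))
            ≈⟨ +-congˡ (solve 4 (λ l d s t → l :* d :- l :* (t :- s) := l :* ((s :+ d) :- t))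
                 refl L (f s * L ⁻¹) s t) ⟩
          (f t + L * (t - s) - f s) + L * (s + f s * L ⁻¹ - t) ∎))

      -- If `f s` were positive, the stretch on which `f` stays nonnegative would either carry `S`
      -- beyond `s` or reach `b`.
      fs≤0 : f s ≤ 0#
      fs≤0 with total 0# (f s)
      ... | inj₂ fs≤0 = fs≤0
      ... | inj₁ 0≤fs with total (s + f s * L ⁻¹) b
      ...   | inj₁ s+δ≤b = begin
        f s      ≈⟨ L*[x*L⁻¹]≈x (f s) ⟨
        L * δ    ≤⟨ *-monoˡ-≤ 0≤L δ≤0 ⟩
        L * 0#   ≈⟨ zeroʳ L ⟩
        0#       ∎
        where
        δ = f s * L ⁻¹

        δ≤0 : δ ≤ 0#
        δ≤0 = ≤-from-diff (diff-nonNeg (no-later (x≤x+y (*-nonNeg 0≤fs 0≤L⁻¹)) ≤-refl s+δ≤b))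
                (solve 2 (λ s d → con (+ 0) :- d := s :- (s :+ d)) refl s δ)
      -- Here `b` lies on the stretch, so `b ≤ s`, and the sign of `f b` decides.
      ...   | inj₂ b≤s+δ = begin
        f s                ≤⟨ lipschitz s≤b ⟩
        f b + L * (b - s)  ≤⟨ +-mono-≤ fb≤0 (*-monoˡ-≤ 0≤L b-s≤0) ⟩
        0# + L * 0#        ≈⟨ solve 1 (λ l → con (+ 0) :+ l :* con (+ 0) := con (+ 0)) refl L ⟩
        0#                 ∎
        where
        b-s≤0 : b - s ≤ 0#
        b-s≤0 = ≤-from-diff (diff-nonNeg (no-later s≤b b≤s+δ ≤-refl))
                  (solve 2 (λ s b → con (+ 0) :- (b :- s) := s :- b) refl s b)

      -- For `t` in `S` the descent bound gives `0# ≤ f t ≤ f s + L * (s - t)`, that is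
      -- `t ≤ s + f s * L ⁻¹`. If `f s` were negative, this would be an upper bound of `S` below
      -- `s`.
      0≤fs : 0# ≤ f s
      0≤fs with total 0# (f s)
      ... | inj₁ 0≤fs = 0≤fs
      ... | inj₂ fs≤0 = begin
        0#          ≈⟨ zeroʳ L ⟨
        L * 0#      ≤⟨ *-monoˡ-≤ 0≤L 0≤δ ⟩
        L * δ       ≈⟨ L*[x*L⁻¹]≈x (f s) ⟩
        f s         ∎
        where
        δ = f s * L ⁻¹

        s+δ-bound : ∀ t → S t → t ≤ s + δ
        s+δ-bound t (t≤b , 0≤ft) = *-cancelˡ-≤ 0≤L L≉0 (≤-from-diff
          (+-nonNeg 0≤ft (diff-nonNeg (lipschitz (bound (t≤b , 0≤ft)))))
          (begin-equality
            L * (s + δ) - L * t                  ≈⟨ solve 4 (λ l s d t → l :* (s :+ d) :- l :* t := l :* d :+ l :* (s :- t))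
                   refl L s δ t ⟩
            L * δ + L * (s - t)                  ≈⟨ +-congʳ (L*[x*L⁻¹]≈x (f s)) ⟩
            f s + L * (s - t)                    ≈⟨ solve 2 (λ x y → y := x :+ (y :- x))
                   refl (f t) (f s + L * (s - t)) ⟩
            f t + (f s + L * (s - t) - f t)      ∎))

        0≤δ : 0# ≤ δ
        0≤δ = ≤-from-diff (diff-nonNeg (least s+δ-bound))
                (solve 2 (λ s d → d :- con (+ 0) := (s :+ d) :- s) refl s δ)

    -- The one-sided hypothesis `lipschitz` limits only how fast `f` may fall; upward jumps do no
    -- harm, since the crossing goes from nonnegative to nonpositive values.
    intermediateValue : ∃ λ t → 0# ≤ t × t ≤ b × f t ≈ 0#
    intermediateValue = s , bound (0≤b , 0≤f0) , s≤b , antisym fs≤0 0≤fs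

-- Finite sums, inner products and squared distances.

module Vectors (em : ExcludedMiddle 0ℓ) (ℝ : CompleteOrderedField) where

  open OrderedField ℝ public
  open OWL em ℝ public
    hiding (Carrier; _≈_; _+_; _*_; -_; _-_; 0#; 1#; _⁻¹; _≤_; _<_)
  open Sum +-commutativeMonoid public using (sum; sum-cong-≋; sum-cong-≗; ∑-distrib-+; sum-permute; sum-remove)
  open SemiringSum semiring public using (*-distribˡ-sum)

  private
    variable
      n : ℕ

  sum-mono-≤ : {f g : Vector Carrier n} → (∀ i → f i ≤ g i) → sum f ≤ sum g
  sum-mono-≤ {zero}  f≤g = ≤-refl
  sum-mono-≤ {suc n} f≤g = +-mono-≤ (f≤g zero) (sum-mono-≤ (f≤g ∘ suc))

  sum-nonNeg : {f : Vector Carrier n} → (∀ i → 0# ≤ f i) → 0# ≤ sum f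
  sum-nonNeg {zero}  0≤f = ≤-refl
  sum-nonNeg {suc n} 0≤f = +-nonNeg (0≤f zero) (sum-nonNeg (0≤f ∘ suc))

  term≤sum : {f : Vector Carrier n} → (∀ i → 0# ≤ f i) → ∀ i → f i ≤ sum f
  term≤sum 0≤f zero = x≤x+y (sum-nonNeg (0≤f ∘ suc))
  term≤sum {f = f} 0≤f (suc i) = begin
    f (suc i)                ≤⟨ term≤sum (0≤f ∘ suc) i ⟩
    sum (f ∘ suc)            ≤⟨ x≤x+y (0≤f zero) ⟩
    sum (f ∘ suc) + f zero   ≈⟨ +-comm _ _ ⟩
    sum f                    ∎

  sum-zero : {f : Vector Carrier n} → (∀ i → f i ≈ 0#) → sum f ≈ 0#
  sum-zero {zero}  f≈0 = refl
  sum-zero {suc n} f≈0 = trans (+-cong (f≈0 zero) (sum-zero (f≈0 ∘ suc))) (+-identityˡ 0#)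

  sum-single : (f : Vector Carrier n) (k : Fin n) → (∀ i → i ≢ k → f i ≈ 0#) → sum f ≈ f k
  sum-single {suc n} f k f≈0 = begin-equality
    sum f                        ≈⟨ sum-remove {i = k} f ⟩
    f k + sum (f ∘ punchIn k)    ≈⟨ +-congˡ (sum-zero (λ i → f≈0 (punchIn k i) (Fin.punchInᵢ≢i k i))) ⟩
    f k + 0#                     ≈⟨ +-identityʳ (f k) ⟩
    f k                          ∎

  ≋-refl : {x : Vector Carrier n} → x ≋ x
  ≋-refl _ = refl

  ∙-cong : {x x′ y y′ : Vector Carrier n} → x ≋ x′ → y ≋ y′ → x ∙ y ≈ x′ ∙ y′
  ∙-cong x≋x′ y≋y′ = sum-cong-≋ (λ i → *-cong (x≋x′ i) (y≋y′ i))

  ∙-comm : (x y : Vector Carrier n) → x ∙ y ≈ y ∙ x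
  ∙-comm x y = sum-cong-≋ (λ i → *-comm (x i) (y i))

  ∙-monoʳ-≤ : {w x y : Vector Carrier n} → (∀ i → 0# ≤ w i) →
              (∀ i → x i ≤ y i) → w ∙ x ≤ w ∙ y
  ∙-monoʳ-≤ 0≤w x≤y = sum-mono-≤ (λ i → *-monoˡ-≤ (0≤w i) (x≤y i))

  ∙-zeroʳ : (x : Vector Carrier n) → x ∙ 0ᵛ ≈ 0#
  ∙-zeroʳ x = sum-zero (λ i → zeroʳ (x i))

  ∙-zeroˡ : (x : Vector Carrier n) → 0ᵛ ∙ x ≈ 0#
  ∙-zeroˡ x = sum-zero (λ i → zeroˡ (x i))

  ·-∙ : ∀ a (x y : Vector Carrier n) → (a ·ᵛ x) ∙ y ≈ a * (x ∙ y)
  ·-∙ a x y = trans (sum-cong-≋ (λ i → *-assoc a (x i) (y i))) (sym (*-distribˡ-sum a (x ⊙ y)))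

  infixl 6 _+ᵛ_

  _+ᵛ_ : Vector Carrier n → Vector Carrier n → Vector Carrier n
  (x +ᵛ y) i = x i + y i

  ∙-distribˡ-+ : (x y z : Vector Carrier n) → x ∙ (y +ᵛ z) ≈ x ∙ y + x ∙ z
  ∙-distribˡ-+ x y z = trans (sum-cong-≋ (λ i → distribˡ (x i) (y i) (z i))) (∑-distrib-+ (x ⊙ y) (x ⊙ z))

  ∙-distribʳ-- : (x y z : Vector Carrier n) → (x -ᵛ y) ∙ z ≈ x ∙ z - y ∙ z
  ∙-distribʳ-- x y z = begin-equality
    (x -ᵛ y) ∙ z                               ≈⟨ solve 2 (λ s t → s := (s :+ t) :- t) refl _ (y ∙ z) ⟩
    ((x -ᵛ y) ∙ z + y ∙ z) - y ∙ z             ≈⟨ +-congʳ (∑-distrib-+ ((x -ᵛ y) ⊙ z) (y ⊙ z)) ⟨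
    sum (λ i → (x i - y i) * z i + y i * z i) - y ∙ z
      ≈⟨ +-congʳ (sum-cong-≋ (λ i → solve 3 (λ x y z → (x :- y) :* z :+ y :* z := x :* z)
           refl (x i) (y i) (z i))) ⟩
    x ∙ z - y ∙ z ∎

  ∙-distribˡ-- : (x y z : Vector Carrier n) → x ∙ (y -ᵛ z) ≈ x ∙ y - x ∙ z
  ∙-distribˡ-- x y z = begin-equality
    x ∙ (y -ᵛ z)   ≈⟨ ∙-comm x (y -ᵛ z) ⟩
    (y -ᵛ z) ∙ x   ≈⟨ ∙-distribʳ-- y z x ⟩
    y ∙ x - z ∙ x  ≈⟨ +-cong (∙-comm y x) (-‿cong (∙-comm z x)) ⟩
    x ∙ y - x ∙ z  ∎

  distance²-expand : (x y : Vector Carrier n) →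
                     distance² x y ≈ x ∙ x - (x ∙ y + x ∙ y) + y ∙ y
  distance²-expand x y = begin-equality
    (x -ᵛ y) ∙ (x -ᵛ y)                       ≈⟨ ∙-distribʳ-- x y (x -ᵛ y) ⟩
    x ∙ (x -ᵛ y) - y ∙ (x -ᵛ y)               ≈⟨ +-cong (∙-distribˡ-- x x y) (-‿cong (∙-distribˡ-- y x y)) ⟩
    (x ∙ x - x ∙ y) - (y ∙ x - y ∙ y)         ≈⟨ +-congˡ (-‿cong (+-congʳ (∙-comm y x))) ⟩
    (x ∙ x - x ∙ y) - (x ∙ y - y ∙ y)
      ≈⟨ solve 3 (λ a b c → (a :- b) :- (b :- c) := (a :- (b :+ b)) :+ c) refl (x ∙ x) (x ∙ y) (y ∙ y) ⟩
    x ∙ x - (x ∙ y + x ∙ y) + y ∙ y ∎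

  ∙-self-nonNeg : (x : Vector Carrier n) → 0# ≤ x ∙ x
  ∙-self-nonNeg x = sum-nonNeg (λ i → square-nonNeg (x i))

  square≤0⇒≈0 : ∀ {x} → x * x ≤ 0# → x ≈ 0#
  square≤0⇒≈0 {x} x²≤0 with em {x ≈ 0#}
  ... | yes x≈0 = x≈0
  ... | no  x≉0 = begin-equality
    x               ≈⟨ *-identityʳ x ⟨
    x * 1#          ≈⟨ *-congˡ (*-inverseʳ x x≉0) ⟨
    x * (x * x ⁻¹)  ≈⟨ *-assoc x x (x ⁻¹) ⟨
    x * x * x ⁻¹    ≈⟨ *-congʳ (antisym x²≤0 (square-nonNeg x)) ⟩
    0# * x ⁻¹       ≈⟨ zeroˡ (x ⁻¹) ⟩
    0#              ∎

  ∙-definite : {x : Vector Carrier n} → x ∙ x ≤ 0# → x ≋ 0ᵛ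
  ∙-definite {x = x} x∙x≤0 i =
    square≤0⇒≈0 (≤-trans (term≤sum (λ j → square-nonNeg (x j)) i) x∙x≤0)

  distance²-definite : {x y : Vector Carrier n} → distance² x y ≤ 0# → x ≋ y
  distance²-definite {x = x} {y} d≤0 i = begin-equality
    x i              ≈⟨ solve 2 (λ x y → x := (x :- y) :+ y) refl (x i) (y i) ⟩
    x i - y i + y i  ≈⟨ +-congʳ (∙-definite {x = x -ᵛ y} d≤0 i) ⟩
    0# + y i         ≈⟨ +-identityˡ (y i) ⟩
    y i              ∎

  +ᵛ-expand : (x y : Vector Carrier n) → (x +ᵛ y) ∙ (x +ᵛ y) ≈ x ∙ x + (x ∙ y + x ∙ y) + y ∙ y
  +ᵛ-expand x y = begin-equality
    (x +ᵛ y) ∙ (x +ᵛ y)                  ≈⟨ ∙-distribˡ-+ (x +ᵛ y) x y ⟩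
    (x +ᵛ y) ∙ x + (x +ᵛ y) ∙ y          ≈⟨ +-cong (∙-comm (x +ᵛ y) x) (∙-comm (x +ᵛ y) y) ⟩
    x ∙ (x +ᵛ y) + y ∙ (x +ᵛ y)          ≈⟨ +-cong (∙-distribˡ-+ x x y) (∙-distribˡ-+ y x y) ⟩
    (x ∙ x + x ∙ y) + (y ∙ x + y ∙ y)    ≈⟨ +-congˡ (+-congʳ (∙-comm y x)) ⟩
    (x ∙ x + x ∙ y) + (x ∙ y + y ∙ y)
      ≈⟨ solve 3 (λ a b c → (a :+ b) :+ (b :+ c) := (a :+ (b :+ b)) :+ c) refl (x ∙ x) (x ∙ y) (y ∙ y) ⟩
    x ∙ x + (x ∙ y + x ∙ y) + y ∙ y ∎

  distance²-zero : (x : Vector Carrier n) → distance² x x ≈ 0#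
  distance²-zero x = trans (distance²-expand x x)
    (solve 1 (λ a → (a :- (a :+ a)) :+ a := con (+ 0)) refl (x ∙ x))

  ∙-shift : (x w : Vector Carrier n) (θ : Carrier) (y : Vector Carrier n) →
            (x -ᵛ θ ·ᵛ w) ∙ y ≈ x ∙ y - θ * (w ∙ y)
  ∙-shift x w θ y = trans (∙-distribʳ-- x (θ ·ᵛ w) y) (+-congˡ (-‿cong (·-∙ θ w y)))

-- Variational projections onto the monotone cone.

module MonotoneCone (em : ExcludedMiddle 0ℓ) (ℝ : CompleteOrderedField) where

  open Vectors em ℝ public

  private
    variable
      n : ℕ

  -- The variational characterisation of the projection onto the cone 𝒦ₘ₊:
  -- x - p is nonpositive on 𝒦ₘ₊ and orthogonal to p.
  IsConeProjection : Vector Carrier n → Vector Carrier n → Set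
  IsConeProjection x p = p ∈ 𝒦ₘ₊ × (∀ y → y ∈ 𝒦ₘ₊ → x ∙ y ≤ p ∙ y) × x ∙ p ≈ p ∙ p

  -- `excess q t` is the entrywise positive part of `q i - t`, the amount cut off by `clip q t`.
  clip excess : Vector Carrier n → Carrier → Vector Carrier n
  clip   q t i = q i ⊓ t
  excess q t   = q -ᵛ clip q t

  excess-nonNeg : (q : Vector Carrier n) (t : Carrier) → ∀ i → 0# ≤ excess q t i
  excess-nonNeg q t i = diff-nonNeg (x⊓y≤x (q i) t)

  clip-∈ : {q : Vector Carrier n} {t : Carrier} → q ∈ 𝒦ₘ₊ → 0# ≤ t → clip q t ∈ 𝒦ₘ₊
  clip-∈ {t = t} (q↘ , 0≤q) 0≤t =
    (λ i j i≤j → ⊓-monoˡ-≤ t (q↘ i j i≤j)) , λ i → ⊓-glb (0≤q i) 0≤t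

  x-x⊓t-mono : ∀ {x y} t → x ≤ y → x - x ⊓ t ≤ y - y ⊓ t
  x-x⊓t-mono {x} {y} t x≤y with ⊓-sel x t
  ... | inj₁ x⊓t≈x = begin
    x - x ⊓ t  ≈⟨ +-congˡ (-‿cong x⊓t≈x) ⟩
    x - x      ≈⟨ -‿inverseʳ x ⟩
    0#         ≤⟨ diff-nonNeg (x⊓y≤x y t) ⟩
    y - y ⊓ t  ∎
  ... | inj₂ x⊓t≈t = begin
    x - x ⊓ t  ≈⟨ +-congˡ (-‿cong x⊓t≈t) ⟩
    x - t      ≤⟨ ≤-from-diff (+-nonNeg (diff-nonNeg x≤y) (diff-nonNeg (x⊓y≤y y t)))
                    (solve 4 (λ x y t m → (y :- m) :- (x :- t) := (y :- x) :+ (t :- m))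
                           refl x y t (y ⊓ t)) ⟩
    y - y ⊓ t  ∎

  -- Makes the excess an admissible test vector in the dual inequality for `q`.
  excess-∈ : {q : Vector Carrier n} {t : Carrier} → q ∈ 𝒦ₘ₊ → excess q t ∈ 𝒦ₘ₊
  excess-∈ {q = q} {t} (q↘ , _) =
    (λ i j i≤j → x-x⊓t-mono t (q↘ i j i≤j)) , excess-nonNeg q t

  x⊓t-lipschitz : ∀ x {s t} → s ≤ t → x ⊓ t ≤ x ⊓ s + (t - s)
  x⊓t-lipschitz x {s} {t} s≤t with ⊓-sel x s
  ... | inj₁ x⊓s≈x = begin
    x ⊓ t            ≤⟨ x⊓y≤x x t ⟩
    x                ≤⟨ x≤x+y (diff-nonNeg s≤t) ⟩
    x + (t - s)      ≈⟨ +-congʳ x⊓s≈x ⟨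
    x ⊓ s + (t - s)  ∎
  ... | inj₂ x⊓s≈s = begin
    x ⊓ t            ≤⟨ x⊓y≤y x t ⟩
    t                ≈⟨ solve 2 (λ s t → t := s :+ (t :- s)) refl s t ⟩
    s + (t - s)      ≈⟨ +-congʳ x⊓s≈s ⟨
    x ⊓ s + (t - s)  ∎

  -- Complementary slackness: either nothing is cut off and both sides vanish, or the clipped value
  -- is `t`.
  [x-x⊓t]*x⊓t : ∀ x t → (x - x ⊓ t) * (x ⊓ t) ≈ (x - x ⊓ t) * t
  [x-x⊓t]*x⊓t x t with ⊓-sel x t
  ... | inj₂ x⊓t≈t = *-congˡ x⊓t≈t
  ... | inj₁ x⊓t≈x = trans (vanishes (x ⊓ t)) (sym (vanishes t))
    where
    vanishes : ∀ y → (x - x ⊓ t) * y ≈ 0#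
    vanishes y = begin-equality
      (x - x ⊓ t) * y  ≈⟨ *-congʳ (+-congˡ (-‿cong x⊓t≈x)) ⟩
      (x - x) * y      ≈⟨ solve 2 (λ x y → (x :- x) :* y := con (+ 0)) refl x y ⟩
      0#               ∎

  -- As `t` grows each entry of the excess falls at rate at most one, so the sum falls at rate at
  -- most the dimension, written here as a sum of ones.
  sum-lipschitz-excess : ∀ {n} (q : Vector Carrier n) → ∀ {s t} → s ≤ t →
    sum (excess q s) ≤ sum (excess q t) + (t - s) * sum {n} (λ _ → 1#)
  sum-lipschitz-excess {n} q {s} {t} s≤t = begin
    sum (excess q s)
      ≤⟨ sum-mono-≤ {n = n} (λ i → ≤-from-diff (diff-nonNeg (x⊓t-lipschitz (q i) s≤t))
           (solve 5 (λ q a b s t → ((q :- b) :+ (t :- s) :* con (+ 1)) :- (q :- a) := (a :+ (t :- s)) :- b)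
             refl (q i) (q i ⊓ s) (q i ⊓ t) s t)) ⟩
    sum (λ i → excess q t i + (t - s) * 1#)
      ≈⟨ ∑-distrib-+ (excess q t) (λ (_ : Fin n) → (t - s) * 1#) ⟩
    sum (excess q t) + sum {n} (λ _ → (t - s) * 1#)
      ≈⟨ +-congˡ (*-distribˡ-sum {n} (t - s) (λ _ → 1#)) ⟨
    sum (excess q t) + (t - s) * sum {n} (λ _ → 1#) ∎

  -- The first entry of a cone projection.

  module _ {n : ℕ} (a : Carrier) (q : Vector Carrier n) where

    private
      -- Minus the derivative in `t` of half of `(a - t)²` plus the squared excesses. The conditions
      -- `f t ≤ 0#` and `t * f t ≈ 0#` are thus the optimality conditions for minimising this over
      -- `t ≥ 0`.
      f : Carrier → Carrier
      f t = (a - t) + sum (excess q t)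

      L : Carrier
      L = 1# + sum {n} (λ _ → 1#)

      0≤Σ1 : 0# ≤ sum {n} (λ _ → 1#)
      0≤Σ1 = sum-nonNeg {n = n} (λ _ → 0≤1)

      L≉0 : ¬ L ≈ 0#
      L≉0 L≈0 = 0≉1 (antisym 0≤1 (≤-respʳ-≈ L≈0 (x≤x+y 0≤Σ1)))

      lipschitz : ∀ {s t} → s ≤ t → f s ≤ f t + L * (t - s)
      lipschitz {s} {t} s≤t = ≤-from-diff (diff-nonNeg (sum-lipschitz-excess q s≤t))
        (solve 6 (λ a s t E F N → (((a :- t) :+ F) :+ (con (+ 1) :+ N) :* (t :- s)) :- ((a :- s) :+ E)
                                 := (F :+ (t :- s) :* N) :- E)
          refl a s t (sum (excess q s)) (sum (excess q t)) (sum {n} (λ _ → 1#)))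

      -- Provides the right end `f 0#` of the search interval. Subtracting `f 0#` cancels `a` and
      -- leaves the excess sum at `f 0#` minus the one at `0#`; the excess decreases in `t`.
      f[f0]≤0 : 0# ≤ f 0# → f (f 0#) ≤ 0#
      f[f0]≤0 0≤f0 = ≤-from-diff
        (diff-nonNeg (sum-mono-≤ (λ i → +-monoʳ-≤ (q i) (neg-mono-≤ (⊓-monoʳ-≤ (q i) 0≤f0)))))
        (solve 3 (λ a E F → con (+ 0) :- ((a :- ((a :- con (+ 0)) :+ E)) :+ F) := E :- F)
          refl a (sum (excess q 0#)) (sum (excess q (f 0#))))

    -- The first entry t of the projection of a ∷ x, where q is the projection of x.
    threshold : ∃ λ t → 0# ≤ t × f t ≤ 0# × t * f t ≈ 0#
    threshold with total (f 0#) 0#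
    ... | inj₁ f0≤0 = 0# , ≤-refl , f0≤0 , zeroˡ (f 0#)
    ... | inj₂ 0≤f0 =
      let t , 0≤t , _ , ft≈0 = intermediateValue f {L} {f 0#}
                                 (+-nonNeg 0≤1 0≤Σ1) L≉0 0≤f0 lipschitz 0≤f0 (f[f0]≤0 0≤f0)
      in t , 0≤t , ≤-reflexive ft≈0 , trans (*-congˡ ft≈0) (zeroʳ t)

  -- Extending a cone projection by one entry.

  module _ {x : Vector Carrier (suc n)} {q : Vector Carrier n} {t : Carrier}
           (q-proj : IsConeProjection (x ∘ suc) q) (0≤t : 0# ≤ t)
           (ft≤0 : (x zero - t) + sum (excess q t) ≤ 0#)
           (t*ft≈0 : t * ((x zero - t) + sum (excess q t)) ≈ 0#) where

    private
      x′ : Vector Carrier n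
      x′ = x ∘ suc

      c e : Vector Carrier n
      c = clip q t
      e = excess q t

      E : Carrier
      E = sum e

      q∈ : q ∈ 𝒦ₘ₊
      q∈ = proj₁ q-proj

      q-dual : ∀ y → y ∈ 𝒦ₘ₊ → x′ ∙ y ≤ q ∙ y
      q-dual = proj₁ (proj₂ q-proj)

      p : Vector Carrier (suc n)
      p zero    = t
      p (suc i) = c i

      p∈ : p ∈ 𝒦ₘ₊
      p∈ = p↘ , 0≤p
        where
        p↘ : ∀ i j → i Fin.≤ j → p j ≤ p i
        p↘ zero    zero    _         = ≤-refl
        p↘ zero    (suc j) _         = x⊓y≤y (q j) t
        p↘ (suc i) (suc j) (s≤s i≤j) = proj₁ (clip-∈ q∈ 0≤t) i j i≤j

        0≤p : ∀ i → 0# ≤ p i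
        0≤p zero    = 0≤t
        0≤p (suc i) = proj₂ (clip-∈ q∈ 0≤t) i

      e∙-≤ : ∀ y → y ∈ 𝒦ₘ₊ → e ∙ (y ∘ suc) ≤ y zero * E
      e∙-≤ y (y↘ , _) = begin
        e ∙ (y ∘ suc)              ≤⟨ ∙-monoʳ-≤ (excess-nonNeg q t) (λ i → y↘ zero (suc i) z≤n) ⟩
        e ∙ (λ _ → y zero)         ≈⟨ ∙-comm e (λ _ → y zero) ⟩
        sum (λ i → y zero * e i)   ≈⟨ *-distribˡ-sum (y zero) e ⟨
        y zero * E                 ∎

      -- The gap `p ∙ y - x ∙ y` splits into three nonnegative parts: the dual inequality for `q` on
      -- the tail of `y`, the slack in `e∙-≤`, and `y zero` times the slack in `ft≤0`.
      p-dual : ∀ y → y ∈ 𝒦ₘ₊ → x ∙ y ≤ p ∙ y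
      p-dual y y∈@(y↘ , 0≤y) = ≤-from-diff
        (+-nonNeg
          (+-nonNeg (diff-nonNeg (q-dual (y ∘ suc) ((λ i j i≤j → y↘ (suc i) (suc j) (s≤s i≤j)) , 0≤y ∘ suc)))
                    (diff-nonNeg (e∙-≤ y y∈)))
          (*-nonNeg (0≤y zero) (neg-nonNeg ft≤0)))
        (begin-equality
          (t * y zero + c ∙ (y ∘ suc)) - (x zero * y zero + x′ ∙ (y ∘ suc))
            ≈⟨ solve 7 (λ t y₀ cy x₀ xy qy E →
                 (t :* y₀ :+ cy) :- (x₀ :* y₀ :+ xy)
                 := ((qy :- xy) :+ (y₀ :* E :- (qy :- cy))) :+ y₀ :* :- ((x₀ :- t) :+ E))
                 refl t (y zero) (c ∙ (y ∘ suc)) (x zero) (x′ ∙ (y ∘ suc)) (q ∙ (y ∘ suc)) E ⟩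
          ((q ∙ (y ∘ suc) - x′ ∙ (y ∘ suc)) + (y zero * E - (q ∙ (y ∘ suc) - c ∙ (y ∘ suc)))) + y zero * - ((x zero - t) + E)
            ≈⟨ +-congʳ (+-congˡ (+-congˡ (-‿cong (∙-distribʳ-- q c (y ∘ suc))))) ⟨
          ((q ∙ (y ∘ suc) - x′ ∙ (y ∘ suc)) + (y zero * E - e ∙ (y ∘ suc))) + y zero * - ((x zero - t) + E) ∎)

      -- One direction is duality tested on `c`. For the other, duality is tested on `e`, which is
      -- `q - c`, and the equality of `x′ ∙ q` and `q ∙ q` turns the inequality around.
      x′∙c≈q∙c : x′ ∙ c ≈ q ∙ c
      x′∙c≈q∙c = antisym (q-dual c (clip-∈ q∈ 0≤t)) (≤-from-diff
        (diff-nonNeg (q-dual e (excess-∈ q∈)))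
        (begin-equality
          x′ ∙ c - q ∙ c                                ≈⟨ solve 3 (λ a b c → a :- b := (c :- b) :- (c :- a))
                 refl (x′ ∙ c) (q ∙ c) (q ∙ q) ⟩
          (q ∙ q - q ∙ c) - (q ∙ q - x′ ∙ c)            ≈⟨ +-congˡ (-‿cong (+-congʳ (proj₂ (proj₂ q-proj)))) ⟨
          (q ∙ q - q ∙ c) - (x′ ∙ q - x′ ∙ c)           ≈⟨ +-cong (∙-distribˡ-- q q c) (-‿cong (∙-distribˡ-- x′ q c)) ⟨
          q ∙ e - x′ ∙ e                                ∎))

      e∙c : q ∙ c - c ∙ c ≈ t * E
      e∙c = begin-equality
        q ∙ c - c ∙ c         ≈⟨ ∙-distribʳ-- q c c ⟨
        e ∙ c                 ≈⟨ sum-cong-≋ (λ i → trans ([x-x⊓t]*x⊓t (q i) t) (*-comm (e i) t)) ⟩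
        sum (λ i → t * e i)   ≈⟨ *-distribˡ-sum t e ⟨
        t * E                 ∎

      -- After `e∙c` the two sides differ exactly by the product that `t*ft≈0` makes vanish.
      p-orth : x ∙ p ≈ p ∙ p
      p-orth = begin-equality
        x zero * t + x′ ∙ c                                  ≈⟨ +-congˡ x′∙c≈q∙c ⟩
        x zero * t + q ∙ c
          ≈⟨ solve 4 (λ x t qc cc → x :* t :+ qc := (x :* t :+ (qc :- cc)) :+ cc)
               refl (x zero) t (q ∙ c) (c ∙ c) ⟩
        (x zero * t + (q ∙ c - c ∙ c)) + c ∙ c               ≈⟨ +-congʳ (+-congˡ e∙c) ⟩
        (x zero * t + t * E) + c ∙ c
          ≈⟨ solve 4 (λ x t E cc → (x :* t :+ t :* E) :+ cc := t :* ((x :- t) :+ E) :+ (t :* t :+ cc))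
               refl (x zero) t E (c ∙ c) ⟩
        t * ((x zero - t) + E) + (t * t + c ∙ c)             ≈⟨ +-congʳ t*ft≈0 ⟩
        0# + (t * t + c ∙ c)                                 ≈⟨ +-identityˡ _ ⟩
        t * t + c ∙ c                                        ∎

    ∷-coneProjection : ∃ (IsConeProjection x)
    ∷-coneProjection = p , p∈ , p-dual , p-orth

  coneProjection : (x : Vector Carrier n) → ∃ (IsConeProjection x)
  coneProjection {zero}  x = x , ((λ ()) , λ ()) , (λ _ _ → ≤-refl) , refl
  coneProjection {suc n} x =
    let q , q-proj                 = coneProjection (x ∘ suc)
        t , 0≤t , ft≤0 , t*ft≈0    = threshold (x zero) q
    in ∷-coneProjection {x = x} {q} {t} q-proj 0≤t ft≤0 t*ft≈0

-- Nearest points and their uniqueness.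

module Projection (em : ExcludedMiddle 0ℓ) (ℝ : CompleteOrderedField) where

  open MonotoneCone em ℝ public

  private
    variable
      n : ℕ

  -- The hypothesis is the obtuse angle condition `(x - p) ∙ (y - p) ≤ 0` with the negative terms
  -- moved across. The squared distances differ by twice its slack plus `distance² p y`.
  distance²-≤ : (x p y : Vector Carrier n) → x ∙ y + p ∙ p ≤ x ∙ p + p ∙ y →
                distance² x p ≤ distance² x y
  distance²-≤ x p y le = ≤-from-diff
    (+-nonNeg (+-nonNeg h h) (∙-self-nonNeg (p -ᵛ y)))
    (begin-equality
      distance² x y - distance² x p
        ≈⟨ +-cong (distance²-expand x y) (-‿cong (distance²-expand x p)) ⟩
      (x ∙ x - (x ∙ y + x ∙ y) + y ∙ y) - (x ∙ x - (x ∙ p + x ∙ p) + p ∙ p)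
        ≈⟨ solve 6 (λ xx xy yy xp pp py →
             ((xx :- (xy :+ xy)) :+ yy) :- ((xx :- (xp :+ xp)) :+ pp)
             := (((xp :+ py) :- (xy :+ pp)) :+ ((xp :+ py) :- (xy :+ pp))) :+ ((pp :- (py :+ py)) :+ yy))
             refl (x ∙ x) (x ∙ y) (y ∙ y) (x ∙ p) (p ∙ p) (p ∙ y) ⟩
      (((x ∙ p + p ∙ y) - (x ∙ y + p ∙ p)) + ((x ∙ p + p ∙ y) - (x ∙ y + p ∙ p))) + (p ∙ p - (p ∙ y + p ∙ y) + y ∙ y)
        ≈⟨ +-congˡ (distance²-expand p y) ⟨
      (((x ∙ p + p ∙ y) - (x ∙ y + p ∙ p)) + ((x ∙ p + p ∙ y) - (x ∙ y + p ∙ p))) + distance² p y ∎)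
    where
    h = diff-nonNeg le

  IsMidpoint : Vector Carrier n → Vector Carrier n → Vector Carrier n → Set
  IsMidpoint p q m = ∀ i → m i + m i ≈ p i + q i

  -- With `c` and `d` the differences from `x` to `p` and `q`, the vector `p - q` is `d - c` and
  -- twice `x - m` is `d + c`. The cross terms cancel on adding the two squares.
  parallelogram : {x p q m : Vector Carrier n} → IsMidpoint p q m →
    distance² p q + ((distance² x m + distance² x m) + (distance² x m + distance² x m))
      ≈ (distance² x p + distance² x p) + (distance² x q + distance² x q)
  parallelogram {x = x} {p} {q} {m} mid = begin-equality
    distance² p q + ((M + M) + (M + M))
      ≈⟨ +-cong (∙-cong p-q≋d-c p-q≋d-c) (solve 1 (λ M → (M :+ M) :+ (M :+ M) := (M :+ (M :+ M)) :+ M)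
           refl M) ⟩
    distance² d c + (M + (M + M) + M)
      ≈⟨ +-cong (distance²-expand d c) (sym (+ᵛ-expand b b)) ⟩
    (d ∙ d - (d ∙ c + d ∙ c) + c ∙ c) + (b +ᵛ b) ∙ (b +ᵛ b)
      ≈⟨ +-congˡ (trans (∙-cong b+b≋d+c b+b≋d+c) (+ᵛ-expand d c)) ⟩
    (d ∙ d - (d ∙ c + d ∙ c) + c ∙ c) + (d ∙ d + (d ∙ c + d ∙ c) + c ∙ c)
      ≈⟨ solve 3 (λ dd dc cc → ((dd :- (dc :+ dc)) :+ cc) :+ ((dd :+ (dc :+ dc)) :+ cc) := (cc :+ cc) :+ (dd :+ dd))
           refl (d ∙ d) (d ∙ c) (c ∙ c) ⟩
    (c ∙ c + c ∙ c) + (d ∙ d + d ∙ d) ∎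
    where
    b = x -ᵛ m
    c = x -ᵛ p
    d = x -ᵛ q
    M = distance² x m

    p-q≋d-c : (p -ᵛ q) ≋ (d -ᵛ c)
    p-q≋d-c i = solve 3 (λ x p q → p :- q := (x :- q) :- (x :- p)) refl (x i) (p i) (q i)

    b+b≋d+c : (b +ᵛ b) ≋ (d +ᵛ c)
    b+b≋d+c i = begin-equality
      (x i - m i) + (x i - m i)  ≈⟨ solve 2 (λ x m → (x :- m) :+ (x :- m) := (x :+ x) :- (m :+ m))
             refl (x i) (m i) ⟩
      (x i + x i) - (m i + m i)  ≈⟨ +-congˡ (-‿cong (mid i)) ⟩
      (x i + x i) - (p i + q i)  ≈⟨ solve 3 (λ x p q → (x :+ x) :- (p :+ q) := (x :- q) :+ (x :- p))
             refl (x i) (p i) (q i) ⟩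
      (x i - q i) + (x i - p i)  ∎

  MidpointConvex : Pred (Vector Carrier n) 0ℓ → Set
  MidpointConvex C = ∀ {p q m} → p ∈ C → q ∈ C → IsMidpoint p q m → m ∈ C

  half : Carrier
  half = (1# + 1#) ⁻¹

  half+half≈1 : half + half ≈ 1#
  half+half≈1 = begin-equality
    half + half        ≈⟨ solve 1 (λ h → h :+ h := (con (+ 1) :+ con (+ 1)) :* h) refl half ⟩
    (1# + 1#) * half   ≈⟨ *-inverseʳ (1# + 1#) 2≉0 ⟩
    1#                 ∎
    where
    2≉0 : ¬ 1# + 1# ≈ 0#
    2≉0 2≈0 = 0≉1 (antisym 0≤1 (≤-respʳ-≈ 2≈0 (x≤x+y 0≤1)))

  midpoint : Vector Carrier n → Vector Carrier n → Vector Carrier n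
  midpoint p q i = half * (p i + q i)

  midpoint-isMidpoint : (p q : Vector Carrier n) → IsMidpoint p q (midpoint p q)
  midpoint-isMidpoint p q i = begin-equality
    half * (p i + q i) + half * (p i + q i)  ≈⟨ distribʳ (p i + q i) half half ⟨
    (half + half) * (p i + q i)              ≈⟨ *-congʳ half+half≈1 ⟩
    1# * (p i + q i)                         ≈⟨ *-identityˡ _ ⟩
    p i + q i                                ∎

  -- The midpoint lies in `C`, so it is no nearer to `x` than `p` or `q`. The parallelogram law then
  -- forces `distance² p q ≤ 0#`.
  nearestPoint-unique : {C : Pred (Vector Carrier n) 0ℓ} → MidpointConvex C →
    {x p q : Vector Carrier n} → IsNearestPoint C x p → IsNearestPoint C x q → p ≋ q
  nearestPoint-unique convex {x} {p} {q} (p∈C , p-min) (q∈C , q-min) =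
    distance²-definite (≤-from-diff (+-nonNeg (+-nonNeg P≤M P≤M) (+-nonNeg Q≤M Q≤M))
      (begin-equality
        0# - distance² p q
          ≈⟨ solve 2 (λ D F → con (+ 0) :- D := F :- (D :+ F)) refl (distance² p q) ((M + M) + (M + M)) ⟩
        ((M + M) + (M + M)) - (distance² p q + ((M + M) + (M + M)))
          ≈⟨ +-congˡ (-‿cong (parallelogram {x = x} mid)) ⟩
        ((M + M) + (M + M)) - ((P + P) + (Q + Q))
          ≈⟨ solve 3 (λ M P Q → ((M :+ M) :+ (M :+ M)) :- ((P :+ P) :+ (Q :+ Q))
                             := ((M :- P) :+ (M :- P)) :+ ((M :- Q) :+ (M :- Q))) refl M P Q ⟩
        ((M - P) + (M - P)) + ((M - Q) + (M - Q)) ∎))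
    where
    m   = midpoint p q
    mid = midpoint-isMidpoint p q
    M   = distance² x m
    P   = distance² x p
    Q   = distance² x q
    P≤M = diff-nonNeg (p-min m (convex p∈C q∈C mid))
    Q≤M = diff-nonNeg (q-min m (convex p∈C q∈C mid))

  -- A known nearest point rules out the dummy branch of `proj`. The point returned need not be `p`,
  -- so identifying the two is left to uniqueness.
  proj-isNearestPoint : {C : Pred (Vector Carrier n) 0ℓ} {x p : Vector Carrier n} →
    IsNearestPoint C x p → IsNearestPoint C x (proj C x)
  proj-isNearestPoint {C = C} {x} nearest with em {∃ (IsNearestPoint C x)}
  ... | yes (_ , nearest′) = nearest′
  ... | no  none           = contradiction (_ , nearest) none

  proj-unique : {C : Pred (Vector Carrier n) 0ℓ} → MidpointConvex C →
    {x p : Vector Carrier n} → IsNearestPoint C x p → proj C x ≋ p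
  proj-unique convex nearest = nearestPoint-unique convex (proj-isNearestPoint nearest) nearest

  𝒦ₘ₊-midpointConvex : MidpointConvex (𝒦ₘ₊ {n})
  𝒦ₘ₊-midpointConvex {m = m} (p↘ , 0≤p) (q↘ , 0≤q) mid =
    (λ i j i≤j → double-cancel-≤ (≤-respˡ-≈ (sym (mid j)) (≤-respʳ-≈ (sym (mid i))
      (+-mono-≤ (p↘ i j i≤j) (q↘ i j i≤j))))) ,
    λ i → double-cancel-≤ (≤-respˡ-≈ (sym (+-identityˡ 0#)) (≤-respʳ-≈ (sym (mid i)) (+-nonNeg (0≤p i) (0≤q i))))

  coneProjection-isNearestPoint : {x p : Vector Carrier n} →
    IsConeProjection x p → IsNearestPoint 𝒦ₘ₊ x p
  coneProjection-isNearestPoint {x = x} {p} (p∈ , dual , orth) = p∈ , λ y y∈ →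
    distance²-≤ x p y (≤-trans (+-mono-≤ (dual y y∈) (≤-reflexive (sym orth))) (≤-reflexive (+-comm _ _)))

  proj-𝒦ₘ₊-unique : {x p : Vector Carrier n} → IsConeProjection x p → proj 𝒦ₘ₊ x ≋ p
  proj-𝒦ₘ₊-unique p-proj = proj-unique 𝒦ₘ₊-midpointConvex (coneProjection-isNearestPoint p-proj)

  -- Carries the variational inequalities from the recursively constructed projection over to
  -- `proj`, the two being equal by uniqueness.
  proj-𝒦ₘ₊-isConeProjection : (x : Vector Carrier n) → IsConeProjection x (proj 𝒦ₘ₊ x)
  proj-𝒦ₘ₊-isConeProjection x =
    proj₁ (proj-isNearestPoint (coneProjection-isNearestPoint p-proj)) ,
    (λ y y∈ → ≤-trans (dual y y∈) (≤-reflexive (∙-cong (λ i → sym (eq i)) (λ _ → refl)))) ,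
    (begin-equality
      x ∙ proj 𝒦ₘ₊ x             ≈⟨ ∙-cong (λ _ → refl) eq ⟩
      x ∙ p                      ≈⟨ orth ⟩
      p ∙ p                      ≈⟨ ∙-cong eq eq ⟨
      proj 𝒦ₘ₊ x ∙ proj 𝒦ₘ₊ x    ∎)
    where
    p      = proj₁ (coneProjection x)
    p-proj = proj₂ (coneProjection x)
    dual   = proj₁ (proj₂ p-proj)
    orth   = proj₂ (proj₂ p-proj)
    eq     = proj-𝒦ₘ₊-unique p-proj

-- The rearrangement inequality.

module Ordering (em : ExcludedMiddle 0ℓ) (ℝ : CompleteOrderedField) where

  open Projection em ℝ public

  private
    variable
      n : ℕ

  Antitone : Vector Carrier n → Set
  Antitone a = ∀ i j → i Fin.≤ j → a j ≤ a i

  -- The pair (a k, b 0) is moved to the front by successive exchanges, none of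
  -- which decreases the inner product.
  extract-≤ : (k : Fin (suc n)) {a b : Vector Carrier (suc n)} → Antitone a → Antitone b →
              a k * b zero + sum (λ i → a (punchIn k i) * b (suc i)) ≤ a ∙ b
  extract-≤         zero    a↘ b↘ = ≤-refl
  extract-≤ {suc n} (suc k) {a} {b} a↘ b↘ = ≤-from-diff
    (+-nonNeg
      (diff-nonNeg (extract-≤ k {a ∘ suc} {b ∘ suc} (λ i j i≤j → a↘ (suc i) (suc j) (s≤s i≤j))
                                                    (λ i j i≤j → b↘ (suc i) (suc j) (s≤s i≤j))))
      (*-nonNeg (diff-nonNeg (a↘ zero (suc k) z≤n)) (diff-nonNeg (b↘ zero (suc zero) z≤n))))
    (solve 6 (λ aₖ a₀ b₀ b₁ R T →
        (a₀ :* b₀ :+ T) :- (aₖ :* b₀ :+ (a₀ :* b₁ :+ R))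
        := (T :- (aₖ :* b₁ :+ R)) :+ (a₀ :- aₖ) :* (b₀ :- b₁))
      refl (a (suc k)) (a zero) (b zero) (b (suc zero))
           (sum (λ i → a (suc (punchIn k i)) * b (suc (suc i)))) ((a ∘ suc) ∙ (b ∘ suc)))

  -- Induction on the dimension: `k` is the index that `σ` sends to `zero`. Its term is split off,
  -- the remaining terms are sorted by the induction hypothesis for `Perm.remove k σ`, and
  -- `extract-≤` moves the pair `a k`, `b zero` into place.
  rearrangement : {a b : Vector Carrier n} → Antitone a → Antitone b →
                  (σ : Permutation′ n) → a ∙ (λ i → b (σ ⟨$⟩ʳ i)) ≤ a ∙ b
  rearrangement {zero}          a↘ b↘ σ = ≤-refl
  rearrangement {suc n} {a} {b} a↘ b↘ σ = begin
    a ∙ (λ i → b (σ ⟨$⟩ʳ i))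
      ≈⟨ sum-remove {i = k} (λ i → a i * b (σ ⟨$⟩ʳ i)) ⟩
    a k * b (σ ⟨$⟩ʳ k) + sum (λ i → a (punchIn k i) * b (σ ⟨$⟩ʳ punchIn k i))
      ≡⟨ ≡.cong₂ _+_ (≡.cong (λ j → a k * b j) (Perm.inverseʳ σ))
           (sum-cong-≗ (λ i → ≡.cong (λ j → a (punchIn k i) * b j) (Perm.punchIn-permute′ σ zero i))) ⟩
    a k * b zero + (a ∘ punchIn k) ∙ (λ i → b (suc (Perm.remove k σ ⟨$⟩ʳ i)))
      ≤⟨ +-monoʳ-≤ (a k * b zero) (rearrangement {a = a ∘ punchIn k} {b ∘ suc}
           (λ i j i≤j → a↘ _ _ (Fin.punchIn-mono-≤ k i j i≤j))
           (λ i j i≤j → b↘ (suc i) (suc j) (s≤s i≤j)) (Perm.remove k σ)) ⟩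
    a k * b zero + (a ∘ punchIn k) ∙ (b ∘ suc)
      ≤⟨ extract-≤ k {a} {b} a↘ b↘ ⟩
    a ∙ b ∎
    where
    k = σ ⟨$⟩ˡ zero

  ∙-permute : (x y : Vector Carrier n) (σ : Permutation′ n) →
              x ∙ y ≈ (λ i → x (σ ⟨$⟩ʳ i)) ∙ (λ i → y (σ ⟨$⟩ʳ i))
  ∙-permute x y σ = sum-permute (x ⊙ y) σ

  -- Permuting `b` preserves `b ∙ b` and does not increase `a ∙ b`.
  distance²-rearrangement : {a b : Vector Carrier n} → Antitone a → Antitone b →
    (σ : Permutation′ n) → distance² a b ≤ distance² a (λ i → b (σ ⟨$⟩ʳ i))
  distance²-rearrangement {a = a} {b} a↘ b↘ σ = begin
    distance² a b                                ≈⟨ distance²-expand a b ⟩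
    a ∙ a - (a ∙ b + a ∙ b) + b ∙ b              ≤⟨ +-mono-≤ (+-monoʳ-≤ (a ∙ a) (neg-mono-≤ (+-mono-≤ le le)))
                                                             (≤-reflexive (∙-permute b b σ)) ⟩
    a ∙ a - (a ∙ b′ + a ∙ b′) + b′ ∙ b′          ≈⟨ distance²-expand a b′ ⟨
    distance² a b′                               ∎
    where
    b′ = λ i → b (σ ⟨$⟩ʳ i)
    le = rearrangement {a = a} {b} a↘ b↘ σ

  -- Chebyshev's sum inequality.

  fromℕ-nonNeg : ∀ k → 0# ≤ fromℕ k
  fromℕ-nonNeg zero    = ≤-refl
  fromℕ-nonNeg (suc k) = +-nonNeg 0≤1 (fromℕ-nonNeg k)

  fromℕ-suc≉0 : ∀ k → ¬ fromℕ (suc k) ≈ 0#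
  fromℕ-suc≉0 k eq = 0≉1 (antisym 0≤1 (≤-respʳ-≈ eq (x≤x+y (fromℕ-nonNeg k))))

  -- This is the sum of the inequalities `0# ≤ (c - x i) * (d - y i)`, expanded.
  bounded-products : (c d : Carrier) {x y : Vector Carrier n} →
    (∀ i → x i ≤ c) → (∀ i → y i ≤ d) →
    c * sum y + sum x * d ≤ fromℕ n * (c * d) + x ∙ y
  bounded-products {zero}  c d x≤c y≤d = ≤-reflexive
    (solve 2 (λ c d → c :* con (+ 0) :+ con (+ 0) :* d := con (+ 0) :* (c :* d) :+ con (+ 0)) refl c d)
  bounded-products {suc n} c d {x} {y} x≤c y≤d = ≤-from-diff
    (+-nonNeg (diff-nonNeg (bounded-products c d {x ∘ suc} {y ∘ suc} (x≤c ∘ suc) (y≤d ∘ suc)))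
              (*-nonNeg (diff-nonNeg (x≤c zero)) (diff-nonNeg (y≤d zero))))
    (solve 8 (λ c d x₀ y₀ X Y N D →
        ((con (+ 1) :+ N) :* (c :* d) :+ (x₀ :* y₀ :+ D)) :- (c :* (y₀ :+ Y) :+ (x₀ :+ X) :* d)
        := ((N :* (c :* d) :+ D) :- (c :* Y :+ X :* d)) :+ (c :- x₀) :* (d :- y₀))
      refl c d (x zero) (y zero) (sum (x ∘ suc)) (sum (y ∘ suc)) (fromℕ n) ((x ∘ suc) ∙ (y ∘ suc)))

  -- In the induction step the new cross terms are those of `bounded-products`, with the first
  -- entries, which are the largest, as bounds.
  chebyshev : {x y : Vector Carrier n} → Antitone x → Antitone y →
              sum x * sum y ≤ fromℕ n * (x ∙ y)
  chebyshev {zero}          x↘ y↘ = ≤-reflexive refl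
  chebyshev {suc n} {x} {y} x↘ y↘ = ≤-from-diff
    (+-nonNeg
      (diff-nonNeg (chebyshev {n} {x ∘ suc} {y ∘ suc} (λ i j i≤j → x↘ (suc i) (suc j) (s≤s i≤j))
                                                      (λ i j i≤j → y↘ (suc i) (suc j) (s≤s i≤j))))
      (diff-nonNeg (bounded-products (x zero) (y zero) {x ∘ suc} {y ∘ suc}
        (λ i → x↘ zero (suc i) z≤n) (λ i → y↘ zero (suc i) z≤n))))
    (solve 6 (λ x₀ y₀ X Y N D →
        (con (+ 1) :+ N) :* (x₀ :* y₀ :+ D) :- (x₀ :+ X) :* (y₀ :+ Y)
        := (N :* D :- X :* Y) :+ ((N :* (x₀ :* y₀) :+ D) :- (x₀ :* Y :+ X :* y₀)))
      refl (x zero) (y zero) (sum (x ∘ suc)) (sum (y ∘ suc)) (fromℕ n) ((x ∘ suc) ∙ (y ∘ suc)))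

  -- Sorting as a permutation of indices.

  sort↓-antitone : (x : Vector Carrier n) → Antitone (sort↓ x)
  sort↓-antitone x i j i≤j = lookup-mono-≤ (DecTotalOrder.totalOrder (Flip.decTotalOrder decTotalOrder))
    (Descending.sort-↗ (toList x))
    (≡.subst₂ ℕ._≤_ (≡.sym (Fin.toℕ-cast _ i)) (≡.sym (Fin.toℕ-cast _ j)) i≤j)

  sort↓-permutation : (x : Vector Carrier n) →
    ∃ λ (τ : Permutation′ n) → ∀ i → sort↓ x i ≡ x (τ ⟨$⟩ʳ i)
  sort↓-permutation {n} x = τ , λ i → ≡.trans
    (onIndices-lookup (≡.setoid Carrier) (↭⇒↭ₛ sorted↭) (Fin.cast (≡.sym length-sorted) i))
    (≡.trans
      (≡.cong (List.lookup (toList x)) (≡.sym (Fin.cast-involutive (≡.sym length-x) length-x _)))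
      (List.lookup-tabulate x _))
    where
    sorted↭  = Descending.sort-↭ (toList x)
    length-x = List.length-tabulate x

    length-sorted : List.length (Descending.sort (toList x)) ≡ n
    length-sorted = ≡.trans (↭-length sorted↭) length-x

    τ : Permutation′ n
    -- The list permutation acts on positions in two lists whose lengths equal `n` only
    -- propositionally, hence a cast at either end.
    τ = Perm.cast-id (≡.sym length-sorted) Perm.∘ₚ onIndices (↭⇒↭ₛ sorted↭) Perm.∘ₚ Perm.cast-id length-x

-- Absolute values and signs.

module OWLBall (em : ExcludedMiddle 0ℓ) (ℝ : CompleteOrderedField) where

  open Ordering em ℝ public

  private
    variable
      n : ℕ

  abs-sel : ∀ x → (0# ≤ x × abs x ≡ x) ⊎ (x ≤ 0# × abs x ≡ - x)
  abs-sel x with em {0# ≤ x}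
  ... | yes 0≤x = inj₁ (0≤x , ≡.refl)
  ... | no  0≰x with total 0# x
  ...   | inj₁ 0≤x = contradiction 0≤x 0≰x
  ...   | inj₂ x≤0 = inj₂ (x≤0 , ≡.refl)

  abs-least : ∀ {x y} → x ≤ y → - x ≤ y → abs x ≤ y
  abs-least {x} x≤y -x≤y with abs-sel x
  ... | inj₁ (_ , eq) = ≤-trans (≤-reflexive (reflexive eq)) x≤y
  ... | inj₂ (_ , eq) = ≤-trans (≤-reflexive (reflexive eq)) -x≤y

  x≤abs : ∀ x → x ≤ abs x
  x≤abs x with abs-sel x
  ... | inj₁ (_   , eq) = ≤-reflexive (sym (reflexive eq))
  ... | inj₂ (x≤0 , eq) = ≤-trans x≤0 (≤-trans (neg-nonNeg x≤0) (≤-reflexive (sym (reflexive eq))))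

  abs-nonNeg : ∀ x → 0# ≤ abs x
  abs-nonNeg x with abs-sel x
  ... | inj₁ (0≤x , eq) = ≤-trans 0≤x (≤-reflexive (sym (reflexive eq)))
  ... | inj₂ (x≤0 , eq) = ≤-trans (neg-nonNeg x≤0) (≤-reflexive (sym (reflexive eq)))

  -x≤abs : ∀ x → - x ≤ abs x
  -x≤abs x with abs-sel x
  ... | inj₁ (0≤x , eq) = ≤-trans (≤-from-diff (+-nonNeg 0≤x 0≤x) (solve 1 (λ x → x :- :- x := x :+ x)
         refl x))
                                  (≤-reflexive (sym (reflexive eq)))
  ... | inj₂ (_   , eq) = ≤-reflexive (sym (reflexive eq))

  abs-square : ∀ x → abs x * abs x ≈ x * x
  abs-square x with abs-sel x
  ... | inj₁ (_ , eq) = *-cong (reflexive eq) (reflexive eq)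
  ... | inj₂ (_ , eq) = trans (*-cong (reflexive eq) (reflexive eq))
                          (solve 1 (λ x → :- x :* :- x := x :* x) refl x)

  x*y≤abs*abs : ∀ x y → x * y ≤ abs x * abs y
  x*y≤abs*abs x y with abs-sel x
  ... | inj₁ (0≤x , eq) = ≤-trans (*-monoˡ-≤ 0≤x (x≤abs y)) (≤-reflexive (*-congʳ (sym (reflexive eq))))
  ... | inj₂ (x≤0 , eq) = begin
    x * y         ≈⟨ solve 2 (λ x y → x :* y := :- x :* :- y) refl x y ⟩
    - x * - y     ≤⟨ *-monoˡ-≤ (neg-nonNeg x≤0) (-x≤abs y) ⟩
    - x * abs y   ≈⟨ *-congʳ (reflexive eq) ⟨
    abs x * abs y ∎

  -- By `abs-square` the squares cancel, leaving twice the nonnegative `abs x * abs y - x * y`.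
  abs-diff-square-≤ : ∀ x y → (abs x - abs y) * (abs x - abs y) ≤ (x - y) * (x - y)
  abs-diff-square-≤ x y = ≤-from-diff (+-nonNeg h h) (begin-equality
    (x - y) * (x - y) - (abs x - abs y) * (abs x - abs y)
      ≈⟨ solve 4 (λ x y a b → (x :- y) :* (x :- y) :- (a :- b) :* (a :- b)
                   := ((x :* x :+ y :* y) :- (a :* a :+ b :* b)) :+ ((a :* b :- x :* y) :+ (a :* b :- x :* y)))
           refl x y (abs x) (abs y) ⟩
    ((x * x + y * y) - (abs x * abs x + abs y * abs y)) + _
      ≈⟨ +-congʳ (+-congˡ (-‿cong (+-cong (abs-square x) (abs-square y)))) ⟩
    ((x * x + y * y) - (x * x + y * y)) + _
      ≈⟨ trans (+-congʳ (-‿inverseʳ _)) (+-identityˡ _) ⟩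
    (abs x * abs y - x * y) + (abs x * abs y - x * y) ∎)
    where
    h = diff-nonNeg (x*y≤abs*abs x y)

  abs-midpoint-≤ : ∀ {x y z} → z + z ≈ x + y → abs z + abs z ≤ abs x + abs y
  abs-midpoint-≤ {x} {y} {z} mid with abs-sel z
  ... | inj₁ (_ , eq) = begin
    abs z + abs z  ≈⟨ +-cong (reflexive eq) (reflexive eq) ⟩
    z + z          ≈⟨ mid ⟩
    x + y          ≤⟨ +-mono-≤ (x≤abs x) (x≤abs y) ⟩
    abs x + abs y  ∎
  ... | inj₂ (_ , eq) = begin
    abs z + abs z  ≈⟨ +-cong (reflexive eq) (reflexive eq) ⟩
    - z + - z      ≈⟨ solve 1 (λ z → :- z :+ :- z := :- (z :+ z)) refl z ⟩
    - (z + z)      ≈⟨ -‿cong mid ⟩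
    - (x + y)      ≈⟨ solve 2 (λ x y → :- (x :+ y) := :- x :+ :- y) refl x y ⟩
    - x + - y      ≤⟨ +-mono-≤ (-x≤abs x) (-x≤abs y) ⟩
    abs x + abs y  ∎

  signum-cases : ∀ x → (x ≈ 0# × signum x ≡ 0#) ⊎
                       (abs x ≈ x × signum x ≡ 1#) ⊎ (abs x ≈ - x × signum x ≡ - 1#)
  signum-cases x with em {x ≈ 0#}
  ... | yes x≈0 = inj₁ (x≈0 , ≡.refl)
  ... | no  _ with em {0# ≤ x}
  ...   | yes _ = inj₂ (inj₁ (refl , ≡.refl))
  ...   | no  _ = inj₂ (inj₂ (refl , ≡.refl))

  abs-signum-* : ∀ x {z} → 0# ≤ z → abs (signum x * z) ≤ z
  abs-signum-* x {z} 0≤z with signum x | signum-cases x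
  ... | _ | inj₁ (_ , ≡.refl) = abs-least
    (≤-from-diff 0≤z (solve 1 (λ z → z :- con (+ 0) :* z := z) refl z))
    (≤-from-diff 0≤z (solve 1 (λ z → z :- :- (con (+ 0) :* z) := z) refl z))
  ... | _ | inj₂ (inj₁ (_ , ≡.refl)) = abs-least
    (≤-reflexive (*-identityˡ z))
    (≤-from-diff (+-nonNeg 0≤z 0≤z) (solve 1 (λ z → z :- :- (con (+ 1) :* z) := z :+ z) refl z))
  ... | _ | inj₂ (inj₂ (_ , ≡.refl)) = abs-least
    (≤-from-diff (+-nonNeg 0≤z 0≤z) (solve 1 (λ z → z :- (:- con (+ 1)) :* z := z :+ z) refl z))
    (≤-reflexive (solve 1 (λ z → :- ((:- con (+ 1)) :* z) := z) refl z))

  -- Not an equality in general: where x vanishes so does signum x * z, but z need not.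
  signum-diff-square-≤ : ∀ x z → (x - signum x * z) * (x - signum x * z) ≤ (abs x - z) * (abs x - z)
  signum-diff-square-≤ x z with signum x | signum-cases x
  ... | _ | inj₁ (x≈0 , ≡.refl) = begin
    (x - 0# * z) * (x - 0# * z)    ≈⟨ *-cong eq eq ⟩
    0# * 0#                        ≈⟨ zeroʳ 0# ⟩
    0#                             ≤⟨ square-nonNeg (abs x - z) ⟩
    (abs x - z) * (abs x - z)      ∎
    where
    eq : x - 0# * z ≈ 0#
    eq = trans (+-congʳ x≈0) (solve 1 (λ z → con (+ 0) :- con (+ 0) :* z := con (+ 0)) refl z)
  ... | _ | inj₂ (inj₁ (abs≈x , ≡.refl)) = ≤-reflexive (*-cong eq eq)
    where
    eq : x - 1# * z ≈ abs x - z
    eq = +-cong (sym abs≈x) (-‿cong (*-identityˡ z))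
  ... | _ | inj₂ (inj₂ (abs≈-x , ≡.refl)) = ≤-reflexive (begin-equality
    (x - - 1# * z) * (x - - 1# * z)
      ≈⟨ solve 2 (λ x z → (x :- (:- con (+ 1)) :* z) :* (x :- (:- con (+ 1)) :* z) := (:- x :- z) :* (:- x :- z))
           refl x z ⟩
    (- x - z) * (- x - z)       ≈⟨ *-cong (+-congʳ abs≈-x) (+-congʳ abs≈-x) ⟨
    (abs x - z) * (abs x - z)   ∎)

  -- Permutation matrices as reindexing.

  permutationMatrix-diag : (σ : Permutation′ n) → ∀ {i j} → σ ⟨$⟩ʳ i ≡ j →
                           permutationMatrix σ i j ≡ 1#
  permutationMatrix-diag σ {i} {j} eq =
    ≡.cong (λ b → if b then 1# else 0#) (dec-true (σ ⟨$⟩ʳ i Fin.≟ j) eq)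

  permutationMatrix-offdiag : (σ : Permutation′ n) → ∀ {i j} → σ ⟨$⟩ʳ i ≢ j →
                              permutationMatrix σ i j ≡ 0#
  permutationMatrix-offdiag σ {i} {j} neq =
    ≡.cong (λ b → if b then 1# else 0#) (dec-false (σ ⟨$⟩ʳ i Fin.≟ j) neq)

  permutationMatrix-*ᵥ : (σ : Permutation′ n) (x : Vector Carrier n) →
                         permutationMatrix σ *ᵥ x ≋ λ i → x (σ ⟨$⟩ʳ i)
  permutationMatrix-*ᵥ σ x i = begin-equality
    (permutationMatrix σ *ᵥ x) i
      ≈⟨ sum-single (λ j → permutationMatrix σ i j * x j) (σ ⟨$⟩ʳ i)
           (λ j j≢ → trans (*-congʳ (reflexive (permutationMatrix-offdiag σ (j≢ ∘ ≡.sym)))) (zeroˡ (x j))) ⟩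
    permutationMatrix σ i (σ ⟨$⟩ʳ i) * x (σ ⟨$⟩ʳ i)
      ≈⟨ *-congʳ (reflexive (permutationMatrix-diag σ ≡.refl)) ⟩
    1# * x (σ ⟨$⟩ʳ i)
      ≈⟨ *-identityˡ _ ⟩
    x (σ ⟨$⟩ʳ i) ∎

  permutationMatrixᵀ-*ᵥ : (σ : Permutation′ n) (x : Vector Carrier n) →
                          permutationMatrix σ ᵀ *ᵥ x ≋ λ j → x (σ ⟨$⟩ˡ j)
  permutationMatrixᵀ-*ᵥ σ x j = begin-equality
    (permutationMatrix σ ᵀ *ᵥ x) j
      ≈⟨ sum-single (λ i → permutationMatrix σ i j * x i) (σ ⟨$⟩ˡ j)
           (λ i i≢ → trans (*-congʳ (reflexive (permutationMatrix-offdiag σ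
             (λ σi≡j → i≢ (≡.trans (≡.sym (Perm.inverseˡ σ)) (≡.cong (σ ⟨$⟩ˡ_) σi≡j)))))) (zeroˡ (x i))) ⟩
    permutationMatrix σ (σ ⟨$⟩ˡ j) j * x (σ ⟨$⟩ˡ j)
      ≈⟨ *-congʳ (reflexive (permutationMatrix-diag σ (Perm.inverseʳ σ))) ⟩
    1# * x (σ ⟨$⟩ˡ j)
      ≈⟨ *-identityˡ _ ⟩
    x (σ ⟨$⟩ˡ j) ∎

  -- The OWL norm as a maximum over permutations, and convexity of its balls.

  ∣∣↓-∈ : (x : Vector Carrier n) → ∣ x ∣↓ ∈ 𝒦ₘ₊
  ∣∣↓-∈ x = sort↓-antitone ∣ x ∣ , λ i →
    ≤-trans (abs-nonNeg _) (≤-reflexive (sym (reflexive (proj₂ (sort↓-permutation ∣ x ∣) i))))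

  permuted-∣∣ : (x : Vector Carrier n) (π : Permutation′ n) →
    ∃ λ (ρ : Permutation′ n) → ∀ i → ∣ x ∣ (π ⟨$⟩ʳ i) ≈ ∣ x ∣↓ (ρ ⟨$⟩ʳ i)
  permuted-∣∣ x π = π Perm.∘ₚ Perm.flip τ , λ i → reflexive (≡.sym (≡.trans (τ-sorts _)
    (≡.cong ∣ x ∣ (Perm.inverseʳ τ))))
    where
    τ       = proj₁ (sort↓-permutation ∣ x ∣)
    τ-sorts = proj₂ (sort↓-permutation ∣ x ∣)

  -- Any permutation of `∣ x ∣` is also one of `∣ x ∣↓`, so the rearrangement inequality applies.
  -- Together with `Ω-attained` this exhibits `Ω w x` as a maximum.
  permuted-≤-Ω : {w : Vector Carrier n} → Antitone w → (x : Vector Carrier n) (π : Permutation′ n) →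
                 w ∙ (λ i → ∣ x ∣ (π ⟨$⟩ʳ i)) ≤ Ω w x
  permuted-≤-Ω {w = w} w↘ x π = ≤-trans
    (≤-reflexive (∙-cong {x = w} (λ _ → refl) (proj₂ (permuted-∣∣ x π))))
    (rearrangement w↘ (sort↓-antitone ∣ x ∣) (proj₁ (permuted-∣∣ x π)))

  Ω-attained : (w x : Vector Carrier n) →
    Ω w x ≈ w ∙ (λ i → ∣ x ∣ (proj₁ (sort↓-permutation ∣ x ∣) ⟨$⟩ʳ i))
  Ω-attained w x = ∙-cong {x = w} (λ _ → refl) (λ i → reflexive (proj₂ (sort↓-permutation ∣ x ∣) i))

  -- The permutation that sorts `∣ m ∣` is used for all three vectors: it attains `Ω w m` and gives
  -- lower bounds for `Ω w p` and `Ω w q`, while absolute values satisfy the triangle inequality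
  -- entrywise.
  𝒢-midpointConvex : {w : Vector Carrier n} → w ∈ 𝒦ₘ₊ → (ε : Carrier) → MidpointConvex (𝒢 ε w)
  𝒢-midpointConvex {w = w} (w↘ , 0≤w) ε {p} {q} {m} p∈ q∈ mid = double-cancel-≤ (begin
    Ω w m + Ω w m                ≈⟨ +-cong (Ω-attained w m) (Ω-attained w m) ⟩
    w ∙ m′ + w ∙ m′              ≈⟨ ∙-distribˡ-+ w m′ m′ ⟨
    w ∙ (m′ +ᵛ m′)               ≤⟨ ∙-monoʳ-≤ {w = w} 0≤w (λ i → abs-midpoint-≤ (mid (τ ⟨$⟩ʳ i))) ⟩
    w ∙ (p′ +ᵛ q′)               ≈⟨ ∙-distribˡ-+ w p′ q′ ⟩
    w ∙ p′ + w ∙ q′              ≤⟨ +-mono-≤ (permuted-≤-Ω w↘ p τ) (permuted-≤-Ω w↘ q τ) ⟩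
    Ω w p + Ω w q                ≤⟨ +-mono-≤ p∈ q∈ ⟩
    ε + ε                        ∎)
    where
    τ  = proj₁ (sort↓-permutation ∣ m ∣)
    m′ = λ i → ∣ m ∣ (τ ⟨$⟩ʳ i)
    p′ = λ i → ∣ p ∣ (τ ⟨$⟩ʳ i)
    q′ = λ i → ∣ q ∣ (τ ⟨$⟩ʳ i)

-- Projection onto the OWL ball.

module BallProjection (em : ExcludedMiddle 0ℓ) (ℝ : CompleteOrderedField) where

  open OWLBall em ℝ public

  private
    variable
      n : ℕ

  ∈𝒢⇒proj-𝒢≋ : {w : Vector Carrier n} → w ∈ 𝒦ₘ₊ → ∀ {ε} (v : Vector Carrier n) →
               v ∈ 𝒢 ε w → proj (𝒢 ε w) v ≋ v
  ∈𝒢⇒proj-𝒢≋ w∈ v v∈𝒢 = proj-unique (𝒢-midpointConvex w∈ _)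
    (v∈𝒢 , λ y _ → ≤-respˡ-≈ (sym (distance²-zero v)) (∙-self-nonNeg (v -ᵛ y)))

  -- For d = p - p′ and δ = t - s, the two variational inequalities give
  -- d∙d ≤ δ (w∙d); combined with 0 ≤ (d - δw)∙(d - δw) this yields δ (w∙d) ≤ δ² (w∙w).
  coneProjection-lipschitz : {u w p p′ : Vector Carrier n} {s t : Carrier} → s ≤ t →
    IsConeProjection (u -ᵛ s ·ᵛ w) p → IsConeProjection (u -ᵛ t ·ᵛ w) p′ →
    w ∙ p ≤ w ∙ p′ + (w ∙ w) * (t - s)
  coneProjection-lipschitz {u = u} {w} {p} {p′} {s} {t} s≤t (p∈ , dual , orth) (p′∈ , dual′ , orth′) =
    ≤-from-diff (diff-nonNeg w∙d≤) (begin-equality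
      (w ∙ p′ + (w ∙ w) * δ) - w ∙ p
        ≈⟨ solve 4 (λ a b ww δ → (b :+ ww :* δ) :- a := δ :* ww :- (a :- b))
             refl (w ∙ p) (w ∙ p′) (w ∙ w) δ ⟩
      δ * (w ∙ w) - (w ∙ p - w ∙ p′)   ≈⟨ +-congˡ (-‿cong (∙-distribˡ-- w p p′)) ⟨
      δ * (w ∙ w) - w ∙ d              ∎)
    where
    δ = t - s
    d = p -ᵛ p′

    d∙d≤ : d ∙ d ≤ δ * (w ∙ d)
    d∙d≤ = ≤-from-diff (+-nonNeg (diff-nonNeg (dual p′ p′∈)) (diff-nonNeg (dual′ p p∈)))
      (begin-equality
        δ * (w ∙ d) - d ∙ d
          ≈⟨ +-cong (*-congˡ (∙-distribˡ-- w p p′)) (-‿cong (distance²-expand p p′)) ⟩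
        δ * (w ∙ p - w ∙ p′) - (p ∙ p - (p ∙ p′ + p ∙ p′) + p′ ∙ p′)
          ≈⟨ +-congˡ (-‿cong (+-cong (+-congʳ (trans (sym orth) (∙-shift u w s p)))
                                     (trans (sym orth′) (∙-shift u w t p′)))) ⟩
        δ * (w ∙ p - w ∙ p′) - ((u ∙ p - s * (w ∙ p)) - (p ∙ p′ + p ∙ p′) + (u ∙ p′ - t * (w ∙ p′)))
          ≈⟨ solve 7 (λ s t wp wp′ pp′ up up′ →
               (t :- s) :* (wp :- wp′) :- (((up :- s :* wp) :- (pp′ :+ pp′)) :+ (up′ :- t :* wp′))
               := (pp′ :- (up′ :- s :* wp′)) :+ (pp′ :- (up :- t :* wp)))
               refl s t (w ∙ p) (w ∙ p′) (p ∙ p′) (u ∙ p) (u ∙ p′) ⟩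
        (p ∙ p′ - (u ∙ p′ - s * (w ∙ p′))) + (p ∙ p′ - (u ∙ p - t * (w ∙ p)))
          ≈⟨ +-cong (+-congˡ (-‿cong (∙-shift u w s p′))) (+-cong (∙-comm p′ p) (-‿cong (∙-shift u w t p))) ⟨
        (p ∙ p′ - (u -ᵛ s ·ᵛ w) ∙ p′) + (p′ ∙ p - (u -ᵛ t ·ᵛ w) ∙ p) ∎)

    δ*[w∙d]≤ : δ * (w ∙ d) ≤ δ * (δ * (w ∙ w))
    δ*[w∙d]≤ = ≤-from-diff
      (+-nonNeg (∙-self-nonNeg (d -ᵛ δ ·ᵛ w)) (diff-nonNeg d∙d≤))
      (begin-equality
        δ * (δ * (w ∙ w)) - δ * (w ∙ d)
          ≈⟨ solve 4 (λ δ ww wd dd → δ :* (δ :* ww) :- δ :* wd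
                       := ((dd :- (δ :* wd :+ δ :* wd)) :+ δ :* (δ :* ww)) :+ (δ :* wd :- dd))
               refl δ (w ∙ w) (w ∙ d) (d ∙ d) ⟩
        ((d ∙ d - (δ * (w ∙ d) + δ * (w ∙ d))) + δ * (δ * (w ∙ w))) + (δ * (w ∙ d) - d ∙ d)
          ≈⟨ +-congʳ (+-cong (+-congˡ (-‿cong (+-cong d∙δw d∙δw))) δw∙δw) ⟨
        ((d ∙ d - (d ∙ (δ ·ᵛ w) + d ∙ (δ ·ᵛ w))) + (δ ·ᵛ w) ∙ (δ ·ᵛ w)) + (δ * (w ∙ d) - d ∙ d)
          ≈⟨ +-congʳ (distance²-expand d (δ ·ᵛ w)) ⟨
        distance² d (δ ·ᵛ w) + (δ * (w ∙ d) - d ∙ d) ∎)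
      where
      d∙δw : d ∙ (δ ·ᵛ w) ≈ δ * (w ∙ d)
      d∙δw = trans (∙-comm d (δ ·ᵛ w)) (·-∙ δ w d)

      δw∙δw : (δ ·ᵛ w) ∙ (δ ·ᵛ w) ≈ δ * (δ * (w ∙ w))
      δw∙δw = trans (·-∙ δ w (δ ·ᵛ w)) (*-congˡ (trans (∙-comm w (δ ·ᵛ w)) (·-∙ δ w w)))

    w∙d≤ : w ∙ d ≤ δ * (w ∙ w)
    w∙d≤ with em {δ ≈ 0#}
    ... | no  δ≉0 = *-cancelˡ-≤ (diff-nonNeg s≤t) δ≉0 δ*[w∙d]≤
    -- Division by `δ` is impossible here, but `d∙d≤` already forces `d` to vanish.
    ... | yes δ≈0 = begin
      w ∙ d          ≈⟨ trans (∙-cong (≋-refl {x = w}) d≋0) (∙-zeroʳ w) ⟩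
      0#             ≈⟨ zeroˡ (w ∙ w) ⟨
      0# * (w ∙ w)   ≈⟨ *-congʳ δ≈0 ⟨
      δ * (w ∙ w)    ∎
      where
      d≋0 : d ≋ 0ᵛ
      d≋0 = ∙-definite {x = d} (≤-trans d∙d≤ (≤-reflexive (trans (*-congʳ δ≈0) (zeroˡ (w ∙ d)))))

  -- Existence of a root of g.

  module _ {m : ℕ} {w : Vector Carrier (suc m)} (w∈ : w ∈ 𝒦ₘ₊) (w≉0 : ¬ w ≋ 0ᵛ) where

    private
      N w̄ : Carrier
      N = fromℕ (suc m)
      w̄ = ‖ w ‖₁ * N ⁻¹

      0≤N : 0# ≤ N
      0≤N = fromℕ-nonNeg (suc m)

      N*w̄≈‖w‖₁ : N * w̄ ≈ ‖ w ‖₁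
      N*w̄≈‖w‖₁ = begin-equality
        N * (‖ w ‖₁ * N ⁻¹)  ≈⟨ solve 3 (λ n x k → n :* (x :* k) := x :* (n :* k)) refl N ‖ w ‖₁ (N ⁻¹) ⟩
        ‖ w ‖₁ * (N * N ⁻¹)  ≈⟨ *-congˡ (*-inverseʳ N (fromℕ-suc≉0 m)) ⟩
        ‖ w ‖₁ * 1#          ≈⟨ *-identityʳ ‖ w ‖₁ ⟩
        ‖ w ‖₁               ∎

      0≤w̄ : 0# ≤ w̄
      0≤w̄ = *-nonNeg (sum-nonNeg (λ i → abs-nonNeg (w i))) (⁻¹-nonNeg 0≤N (fromℕ-suc≉0 m))

      w̄≉0 : ¬ w̄ ≈ 0#
      w̄≉0 w̄≈0 = w≉0 λ i → antisym
        (begin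
          w i         ≤⟨ x≤abs (w i) ⟩
          abs (w i)   ≤⟨ term≤sum (λ j → abs-nonNeg (w j)) i ⟩
          ‖ w ‖₁      ≈⟨ N*w̄≈‖w‖₁ ⟨
          N * w̄       ≈⟨ *-congˡ w̄≈0 ⟩
          N * 0#      ≈⟨ zeroʳ N ⟩
          0#          ∎)
        (proj₂ w∈ i)

      -- Chebyshev's inequality for the two non-increasing vectors `w` and `y`, divided by the
      -- dimension `N`.
      w̄*sum≤ : {y : Vector Carrier (suc m)} → y ∈ 𝒦ₘ₊ → w̄ * sum y ≤ w ∙ y
      w̄*sum≤ {y} (y↘ , 0≤y) = *-cancelˡ-≤ 0≤N (fromℕ-suc≉0 m) (begin
        N * (w̄ * sum y)    ≈⟨ *-assoc N w̄ (sum y) ⟨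
        N * w̄ * sum y      ≈⟨ *-congʳ N*w̄≈‖w‖₁ ⟩
        ‖ w ‖₁ * sum y     ≤⟨ *-monoʳ-≤ (sum-nonNeg 0≤y) (sum-mono-≤ (λ i → abs-least ≤-refl (-w≤w i))) ⟩
        sum w * sum y      ≤⟨ chebyshev {x = w} {y} (proj₁ w∈) y↘ ⟩
        N * (w ∙ y)        ∎)
        where
        -w≤w : ∀ i → - w i ≤ w i
        -w≤w i = ≤-from-diff (+-nonNeg (proj₂ w∈ i) (proj₂ w∈ i)) (solve 1 (λ x → x :- :- x := x :+ x)
               refl (w i))

    module _ {u : Vector Carrier (suc m)} (u∈ : u ∈ 𝒦ₘ₊) where

      private
        θ̂ : Carrier
        θ̂ = u zero * w̄ ⁻¹

        -- Every entry of `u` is at most `u zero`, which equals `θ̂ * w̄`; then `w̄*sum≤` applies.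
        u∙y≤ : {y : Vector Carrier (suc m)} → y ∈ 𝒦ₘ₊ → u ∙ y ≤ θ̂ * (w ∙ y)
        u∙y≤ {y} y∈@(_ , 0≤y) = begin
          u ∙ y                        ≈⟨ ∙-comm u y ⟩
          y ∙ u                        ≤⟨ ∙-monoʳ-≤ {w = y} 0≤y (λ i → proj₁ u∈ zero i z≤n) ⟩
          y ∙ (λ _ → u zero)           ≈⟨ ∙-comm y (λ _ → u zero) ⟩
          sum (λ i → u zero * y i)     ≈⟨ *-distribˡ-sum (u zero) y ⟨
          u zero * sum y               ≈⟨ *-congˡ (trans (*-congʳ (*-inverseʳ w̄ w̄≉0)) (*-identityˡ (sum y))) ⟨
          u zero * (w̄ * w̄ ⁻¹ * sum y)
            ≈⟨ solve 4 (λ a b c d → a :* ((b :* c) :* d) := (a :* c) :* (b :* d))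
                 refl (u zero) w̄ (w̄ ⁻¹) (sum y) ⟩
          θ̂ * (w̄ * sum y)              ≤⟨ *-monoˡ-≤ 0≤θ̂ (w̄*sum≤ y∈) ⟩
          θ̂ * (w ∙ y)                  ∎
          where
          0≤θ̂ = *-nonNeg (proj₂ u∈ zero) (⁻¹-nonNeg 0≤w̄ w̄≉0)

        -- By Chebyshev's sum inequality, u - θ̂w lies in the polar cone of 𝒦ₘ₊.
        coneProjection-θ̂ : IsConeProjection (u -ᵛ θ̂ ·ᵛ w) 0ᵛ
        coneProjection-θ̂ =
          ((λ _ _ _ → ≤-refl) , λ _ → ≤-refl) ,
          (λ y y∈ → ≤-from-diff (diff-nonNeg (u∙y≤ y∈)) (begin-equality
            0ᵛ ∙ y - (u -ᵛ θ̂ ·ᵛ w) ∙ y       ≈⟨ +-cong (∙-zeroˡ y) (-‿cong (∙-shift u w θ̂ y)) ⟩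
            0# - (u ∙ y - θ̂ * (w ∙ y))       ≈⟨ solve 2 (λ a b → con (+ 0) :- (a :- b) := b :- a)
                   refl (u ∙ y) (θ̂ * (w ∙ y)) ⟩
            θ̂ * (w ∙ y) - u ∙ y              ∎)) ,
          trans (∙-zeroʳ (u -ᵛ θ̂ ·ᵛ w)) (sym (∙-zeroʳ {n = suc m} 0ᵛ))

        coneProjection-0 : IsConeProjection (u -ᵛ 0# ·ᵛ w) u
        coneProjection-0 =
          u∈ , (λ y _ → ≤-reflexive (∙-cong u-0w≋u (≋-refl {x = y}))) , ∙-cong u-0w≋u (≋-refl {x = u})
          where
          u-0w≋u : (u -ᵛ 0# ·ᵛ w) ≋ u
          u-0w≋u i = solve 2 (λ u w → u :- con (+ 0) :* w := u) refl (u i) (w i)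

      -- The intermediate value theorem on the interval from `0#` to `θ̂`, where `w ∙ w` bounds the
      -- rate of descent by `coneProjection-lipschitz`.
      exists-root : {ε : Carrier} → 0# ≤ ε → ε ≤ w ∙ u →
        ∃ λ θ → 0# ≤ θ × θ ≤ u zero * w̄ ⁻¹ × w ∙ proj 𝒦ₘ₊ (u -ᵛ θ ·ᵛ w) - ε ≈ 0#
      exists-root {ε} 0≤ε ε≤w∙u = intermediateValue
        (λ θ → w ∙ proj 𝒦ₘ₊ (u -ᵛ θ ·ᵛ w) - ε) {w ∙ w} {θ̂}
        (∙-self-nonNeg w)
        (λ w∙w≈0 → w≉0 (∙-definite {x = w} (≤-reflexive w∙w≈0)))
        (*-nonNeg (proj₂ u∈ zero) (⁻¹-nonNeg 0≤w̄ w̄≉0))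
        (λ {s} {t} s≤t → ≤-from-diff
          (diff-nonNeg (coneProjection-lipschitz {u = u} {w} s≤t
            (proj-𝒦ₘ₊-isConeProjection (u -ᵛ s ·ᵛ w)) (proj-𝒦ₘ₊-isConeProjection (u -ᵛ t ·ᵛ w))))
          (solve 4 (λ a b c ε → ((b :- ε) :+ c) :- (a :- ε) := (b :+ c) :- a) refl _ _ _ ε))
        -- At `0#` the projection is `u` itself, so the value is `w ∙ u - ε`.
        (diff-nonNeg (≤-trans ε≤w∙u (≤-reflexive
          (∙-cong (≋-refl {x = w}) (λ i → sym (proj-𝒦ₘ₊-unique {x = u -ᵛ 0# ·ᵛ w} {u} coneProjection-0 i))))))
        -- At `θ̂` the projection is `0ᵛ`, so the value is `- ε`.
        (≤-from-diff 0≤ε (begin-equality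
          0# - (w ∙ proj 𝒦ₘ₊ (u -ᵛ θ̂ ·ᵛ w) - ε)
            ≈⟨ +-congˡ (-‿cong (+-congʳ (trans (∙-cong (≋-refl {x = w})
                   (proj-𝒦ₘ₊-unique {x = u -ᵛ θ̂ ·ᵛ w} {0ᵛ} coneProjection-θ̂)) (∙-zeroʳ w)))) ⟩
          0# - (0# - ε)  ≈⟨ solve 1 (λ ε → con (+ 0) :- (con (+ 0) :- ε) := ε) refl ε ⟩
          ε              ∎))

  -- From a root of g to the nearest point of the ball.

  distance²-∣∣↓-≤ : (v y : Vector Carrier n) → distance² ∣ v ∣↓ ∣ y ∣↓ ≤ distance² v y
  distance²-∣∣↓-≤ v y = begin
    distance² ∣ v ∣↓ ∣ y ∣↓
      -- The permutation `ρ` is chosen so that `∣ y ∣↓` becomes `∣ y ∣` reindexed by the `τ` that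
      -- sorts `∣ v ∣`; the common reindexing can then be undone.
      ≤⟨ distance²-rearrangement (sort↓-antitone ∣ v ∣) (sort↓-antitone ∣ y ∣) ρ ⟩
    distance² ∣ v ∣↓ (λ i → ∣ y ∣↓ (ρ ⟨$⟩ʳ i))
      ≈⟨ ∙-cong eq eq ⟩
    distance² (λ i → ∣ v ∣ (τ ⟨$⟩ʳ i)) (λ i → ∣ y ∣ (τ ⟨$⟩ʳ i))
      ≈⟨ ∙-permute (∣ v ∣ -ᵛ ∣ y ∣) (∣ v ∣ -ᵛ ∣ y ∣) τ ⟨
    distance² ∣ v ∣ ∣ y ∣
      ≤⟨ sum-mono-≤ (λ i → abs-diff-square-≤ (v i) (y i)) ⟩
    distance² v y ∎
    where
    τ = proj₁ (sort↓-permutation ∣ v ∣)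
    ρ = proj₁ (permuted-∣∣ y τ)

    eq : ∣ v ∣↓ -ᵛ (λ i → ∣ y ∣↓ (ρ ⟨$⟩ʳ i)) ≋ (λ i → ∣ v ∣ (τ ⟨$⟩ʳ i)) -ᵛ (λ i → ∣ y ∣ (τ ⟨$⟩ʳ i))
    eq i = +-cong (reflexive (proj₂ (sort↓-permutation ∣ v ∣) i)) (-‿cong (sym (proj₂ (permuted-∣∣ y τ) i)))

  module _ {w : Vector Carrier n} (w∈ : w ∈ 𝒦ₘ₊) {ε : Carrier} (v : Vector Carrier n)
           (σ : Permutation′ n) (u≋ : ∣ v ∣↓ ≋ λ i → ∣ v ∣ (σ ⟨$⟩ʳ i))
           {θ : Carrier} (0≤θ : 0# ≤ θ) {z : Vector Carrier n}
           (z-proj : IsConeProjection (∣ v ∣↓ -ᵛ θ ·ᵛ w) z) (w∙z≈ε : w ∙ z ≈ ε) where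

    private
      -- In `q` the transposed permutation matrix appears as reindexing by the inverse of `σ`.
      u q : Vector Carrier n
      u   = ∣ v ∣↓
      q j = signum (v j) * z (σ ⟨$⟩ˡ j)

      z∈ : z ∈ 𝒦ₘ₊
      z∈ = proj₁ z-proj

      -- Entrywise `∣ q ∣` is at most a permutation of `z`, and no permutation of `z` pairs with `w`
      -- to more than `w ∙ z`.
      q∈𝒢 : q ∈ 𝒢 ε w
      q∈𝒢 = begin
        Ω w q                              ≈⟨ Ω-attained w q ⟩
        w ∙ (λ i → ∣ q ∣ (τ ⟨$⟩ʳ i))       ≤⟨ ∙-monoʳ-≤ {w = w} (proj₂ w∈)
                                               (λ i → abs-signum-* (v (τ ⟨$⟩ʳ i)) (proj₂ z∈ (σ ⟨$⟩ˡ (τ ⟨$⟩ʳ i)))) ⟩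
        w ∙ (λ i → z (ρ ⟨$⟩ʳ i))           ≤⟨ rearrangement {a = w} {z} (proj₁ w∈) (proj₁ z∈) ρ ⟩
        w ∙ z                              ≈⟨ w∙z≈ε ⟩
        ε                                  ∎
        where
        τ = proj₁ (sort↓-permutation ∣ q ∣)
        ρ = τ Perm.∘ₚ Perm.flip σ

      distance²-v-q≤ : distance² v q ≤ distance² u z
      distance²-v-q≤ = begin
        distance² v q
          ≤⟨ sum-mono-≤ (λ j → signum-diff-square-≤ (v j) (z (σ ⟨$⟩ˡ j))) ⟩
        distance² ∣ v ∣ (λ j → z (σ ⟨$⟩ˡ j))
          ≈⟨ ∙-permute (∣ v ∣ -ᵛ λ j → z (σ ⟨$⟩ˡ j)) (∣ v ∣ -ᵛ λ j → z (σ ⟨$⟩ˡ j)) σ ⟩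
        distance² (λ i → ∣ v ∣ (σ ⟨$⟩ʳ i)) (λ i → z (σ ⟨$⟩ˡ (σ ⟨$⟩ʳ i)))
          ≈⟨ ∙-cong eq eq ⟩
        distance² u z ∎
        where
        eq : (λ i → ∣ v ∣ (σ ⟨$⟩ʳ i)) -ᵛ (λ i → z (σ ⟨$⟩ˡ (σ ⟨$⟩ʳ i))) ≋ u -ᵛ z
        eq i = +-cong (sym (u≋ i)) (-‿cong (reflexive (≡.cong z (Perm.inverseˡ σ))))

      -- Here `θ` is the Lagrange multiplier of the constraint `w ∙ y ≤ ε`, which is active at `z`.
      -- The slack in the obtuse angle condition is that of the dual inequality plus
      -- `θ * (w ∙ z - w ∙ y)`.
      distance²-u-z≤ : ∀ y → y ∈ 𝒦ₘ₊ → w ∙ y ≤ ε → distance² u z ≤ distance² u y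
      distance²-u-z≤ y y∈ w∙y≤ε = distance²-≤ u z y (≤-from-diff
        (+-nonNeg (diff-nonNeg (proj₁ (proj₂ z-proj) y y∈))
                  (*-nonNeg 0≤θ (diff-nonNeg (≤-trans w∙y≤ε (≤-reflexive (sym w∙z≈ε))))))
        (begin-equality
          (u ∙ z + z ∙ y) - (u ∙ y + z ∙ z)
            ≈⟨ +-congˡ (-‿cong (+-congˡ (trans (sym (proj₂ (proj₂ z-proj))) (∙-shift u w θ z)))) ⟩
          (u ∙ z + z ∙ y) - (u ∙ y + (u ∙ z - θ * (w ∙ z)))
            ≈⟨ solve 6 (λ uz zy uy θ wz wy → (uz :+ zy) :- (uy :+ (uz :- θ :* wz))
                         := (zy :- (uy :- θ :* wy)) :+ θ :* (wz :- wy))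
                 refl (u ∙ z) (z ∙ y) (u ∙ y) θ (w ∙ z) (w ∙ y) ⟩
          (z ∙ y - (u ∙ y - θ * (w ∙ y))) + θ * (w ∙ z - w ∙ y)
            ≈⟨ +-congʳ (+-congˡ (-‿cong (∙-shift u w θ y))) ⟨
          (z ∙ y - (u -ᵛ θ ·ᵛ w) ∙ y) + θ * (w ∙ z - w ∙ y) ∎))

    proj-𝒢-root : proj (𝒢 ε w) v ≋ q
    proj-𝒢-root = proj-unique (𝒢-midpointConvex w∈ ε) (q∈𝒢 , λ y y∈𝒢 → begin
      distance² v q         ≤⟨ distance²-v-q≤ ⟩
      -- Membership of `y` in the ball is by definition the linear constraint `w ∙ ∣ y ∣↓ ≤ ε` on
      -- the sorted vector.
      distance² u z         ≤⟨ distance²-u-z≤ ∣ y ∣↓ (∣∣↓-∈ y) y∈𝒢 ⟩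
      distance² u ∣ y ∣↓    ≤⟨ distance²-∣∣↓-≤ v y ⟩
      distance² v y         ∎)

mainTheorem5 :
    (em : ExcludedMiddle 0ℓ) (ℝ : CompleteOrderedField) →
    let open OWL em ℝ in
    (m : ℕ) → let n = suc m in
    (w : Vector Carrier n) → w ∈ 𝒦ₘ₊ → ¬ (w ≋ 0ᵛ) →
    (ε : Carrier) → 0# < ε →
    (v : Vector Carrier n) →
    (Ω w v ≤ ε → proj (𝒢 ε w) v ≋ v) ×
    (ε < Ω w v →
      let u : Vector Carrier n
          u = ∣ v ∣↓
          w̄ : Carrier
          w̄ = ‖ w ‖₁ * fromℕ n ⁻¹
          g : Carrier → Carrier
          g θ = w ∙ proj 𝒦ₘ₊ (u -ᵛ θ ·ᵛ w) - ε
          IsRootInInterval : Carrier → Set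
          IsRootInInterval θ = 0# ≤ θ × θ ≤ u zero * w̄ ⁻¹ × g θ ≈ 0#
      in
      (∃ λ θ → IsRootInInterval θ) ×
      ((σ : Permutation′ n) →
        let P : Matrix
            P = permutationMatrix σ
        in
        u ≋ P *ᵥ ∣ v ∣ →
        (θ* : Carrier) → IsRootInInterval θ* →
        proj (𝒢 ε w) v ≋ sign v ⊙ (P ᵀ *ᵥ proj 𝒦ₘ₊ (u -ᵛ θ* ·ᵛ w))))
mainTheorem5 em ℝ m w w∈ w≉0 ε (0≤ε , _) v =
  ∈𝒢⇒proj-𝒢≋ w∈ v , λ (ε≤Ω , _) →
    exists-root w∈ w≉0 (∣∣↓-∈ v) 0≤ε ε≤Ω ,
    λ σ u≋ θ* (0≤θ* , _ , gθ*≈0) j →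
      let u = ∣ v ∣↓
          z = proj 𝒦ₘ₊ (u -ᵛ θ* ·ᵛ w)
      in trans
        (proj-𝒢-root w∈ v σ (λ i → trans (u≋ i) (permutationMatrix-*ᵥ σ ∣ v ∣ i)) 0≤θ*
          (proj-𝒦ₘ₊-isConeProjection (u -ᵛ θ* ·ᵛ w))
          (begin-equality
            w ∙ z            ≈⟨ solve 2 (λ x ε → x := (x :- ε) :+ ε) refl (w ∙ z) ε ⟩
            (w ∙ z - ε) + ε  ≈⟨ +-congʳ gθ*≈0 ⟩
            0# + ε           ≈⟨ +-identityˡ ε ⟩
            ε                ∎) j)
        (*-congˡ (sym (permutationMatrixᵀ-*ᵥ σ z j)))
  where open BallProjection em ℝ
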